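{- Let $G$ be a block-cycle graph. Then $Z(G)=P(G)$. Furthermore, for every covering of $V(G)$ by $P(G)$ vertex-disjoint induced paths, one can choose one end-point of each of these paths so that the chosen vertices form a minimum zero forcing set of $G$ and there is a chronological list of forces starting from this set whose maximal forcing chains are exactly these paths.
   Context: All graphs are finite, simple and undirected. Zero forcing: vertices are coloured black or white; if a black vertex $u$ has exactly one white neighbour $v$, then $v$ is recoloured black ("$u$ forces $v$"). A set $Z\subseteq V(G)$ is a zero forcing set if, starting with $Z$ black and all other vertices white, repeated application of this rule colours all vertices black; $Z(G)$ is the minimum size of a zero forcing set. Given a zero forcing set, recording the forces in the order performed gives a chronological list of forces; a forcing chain is a sequence $(v_1,\dots,v_k)$ with $v_i$ forcing $v_{i+1}$ for all $i$, and a maximal forcing chain is one not properly contained in another (a single vertex of the initial set that forces nothing is a maximal chain). The path cover number $P(G)$ is the minimum number of vertex-disjoint induced paths of $G$ covering all vertices of $G$. A graph is non-separable if it is connected and has no cut-vertex; a block is a maximal non-separable induced subgraph; a block-cycle graph is a graph in which every block is either an edge or a cycle. -}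

module Defs where

open import Data.Nat using (ℕ; zero; suc; _≤_)
open import Data.Bool using (Bool; true; false)
open import Data.Fin using (Fin; toℕ)
open import Data.Fin.Subset using (Subset; _∈_; _∉_; _⊆_; _∪_; ⁅_⁆; _-_; ∣_∣)
open import Data.List using (List; []; _∷_; _++_; length; lookup; concat; allFin; reverse; head)
open import Data.List.Relation.Unary.Unique.Propositional using (Unique)
open import Data.List.Relation.Unary.Any using (Any)
open import Data.List.Relation.Binary.Pointwise using (Pointwise)
open import Data.List.Relation.Binary.Permutation.Propositional using (_↭_)
import Data.List.Membership.Propositional as L
open import Data.Maybe using (just)
open import Data.Product using (Σ; ∃; ∃-syntax; _×_; _,_)
open import Data.Sum using (_⊎_)
open import Data.Unit using (⊤)
open import Data.Empty using (⊥)
open import Relation.Nullary using (¬_)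
open import Relation.Binary.PropositionalEquality using (_≡_; _≢_)
open import Function.Bundles using (_⇔_)

record Graph (n : ℕ) : Set where
  field
    adj    : Fin n → Fin n → Bool
    sym    : ∀ u v → adj u v ≡ adj v u
    irrefl : ∀ u → adj u u ≡ false

open Graph public

module _ {n : ℕ} (G : Graph n) where

  Adj : Fin n → Fin n → Set
  Adj u v = adj G u v ≡ true

  data WalkIn (S : Subset n) : Fin n → Fin n → Set where
    here : ∀ {x} → x ∈ S → WalkIn S x x
    step : ∀ {x y z} → x ∈ S → Adj x y → WalkIn S y z → WalkIn S x z

  -- G[S] is connected (the empty graph counts as connected vacuously;
  -- nonemptiness is demanded separately where needed)
  ConnectedOn : Subset n → Set
  ConnectedOn S = ∀ x y → x ∈ S → y ∈ S → WalkIn S x y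

  NonSeparable : Subset n → Set
  NonSeparable S =
    (∃[ x ] x ∈ S) × ConnectedOn S × (∀ v → v ∈ S → ConnectedOn (S - v))

  IsBlock : Subset n → Set
  IsBlock S = NonSeparable S × (∀ T → S ⊆ T → NonSeparable T → T ⊆ S)

  IsEdgeOn : Subset n → Set
  IsEdgeOn S = Σ (Fin n) λ u → Σ (Fin n) λ v →
    u ≢ v × Adj u v × (∀ x → x ∈ S ⇔ (x ≡ u ⊎ x ≡ v))

  CycNext : ℕ → ℕ → ℕ → Set
  CycNext k i j = j ≡ suc i ⊎ (suc i ≡ k × j ≡ 0)

  IsCycleOn : Subset n → Set
  IsCycleOn S = Σ (List (Fin n)) λ c →
    Unique c × 3 ≤ length c × (∀ x → x ∈ S ⇔ x L.∈ c) ×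
    (∀ i j → Adj (lookup c i) (lookup c j) ⇔
               (CycNext (length c) (toℕ i) (toℕ j) ⊎ CycNext (length c) (toℕ j) (toℕ i)))

  BlockCycle : Set
  BlockCycle = ∀ S → IsBlock S → IsEdgeOn S ⊎ IsCycleOn S

  Force : Set
  Force = Fin n × Fin n          -- (u , v) : "u forces v"

  CanForce : Subset n → Fin n → Fin n → Set
  CanForce B u v = u ∈ B × v ∉ B × Adj u v × (∀ w → Adj u w → w ≢ v → w ∈ B)

  afterForces : Subset n → List Force → Subset n
  afterForces B []             = B
  afterForces B ((u , v) ∷ fs) = afterForces (B ∪ ⁅ v ⁆) fs

  ValidForces : Subset n → List Force → Set
  ValidForces B []             = ⊤
  ValidForces B ((u , v) ∷ fs) = CanForce B u v × ValidForces (B ∪ ⁅ v ⁆) fs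

  CompleteForcing : Subset n → List Force → Set
  CompleteForcing Z fs = ValidForces Z fs × (∀ x → x ∈ afterForces Z fs)

  IsZeroForcingSet : Subset n → Set
  IsZeroForcingSet Z = ∃[ fs ] CompleteForcing Z fs

  IsMinZeroForcingSet : Subset n → Set
  IsMinZeroForcingSet Z =
    IsZeroForcingSet Z × (∀ Z′ → IsZeroForcingSet Z′ → ∣ Z ∣ ≤ ∣ Z′ ∣)

  IsZeroForcingNumber : ℕ → Set
  IsZeroForcingNumber k =
    (∃[ Z ] IsZeroForcingSet Z × ∣ Z ∣ ≡ k) ×
    (∀ Z → IsZeroForcingSet Z → k ≤ ∣ Z ∣)

  ChainLinks : List Force → List (Fin n) → Set
  ChainLinks fs []           = ⊤
  ChainLinks fs (x ∷ [])     = ⊤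
  ChainLinks fs (x ∷ y ∷ cs) = (x , y) L.∈ fs × ChainLinks fs (y ∷ cs)

  IsForcingChain : List Force → List (Fin n) → Set
  IsForcingChain fs c = c ≢ [] × ChainLinks fs c

  IsMaximalForcingChain : List Force → List (Fin n) → Set
  IsMaximalForcingChain fs c =
    IsForcingChain fs c ×
    ¬ (Σ (List (Fin n)) λ as → Σ (List (Fin n)) λ bs →
         (as ++ bs ≢ []) × IsForcingChain fs (as ++ c ++ bs))

  IsInducedPath : List (Fin n) → Set
  IsInducedPath p =
    p ≢ [] × Unique p ×
    (∀ i j → Adj (lookup p i) (lookup p j) ⇔
               (toℕ j ≡ suc (toℕ i) ⊎ toℕ i ≡ suc (toℕ j)))

  IsPathCover : List (List (Fin n)) → Set
  IsPathCover ps = (∀ p → p L.∈ ps → IsInducedPath p) × (concat ps ↭ allFin n)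

  IsPathCoverNumber : ℕ → Set
  IsPathCoverNumber k =
    (∃[ ps ] IsPathCover ps × length ps ≡ k) ×
    (∀ ps → IsPathCover ps → k ≤ length ps)

  -- qs is obtained from ps by orienting each path (choosing its start end-point)
  Orientation : List (List (Fin n)) → List (List (Fin n)) → Set
  Orientation ps qs = Pointwise (λ p q → q ≡ p ⊎ q ≡ reverse p) ps qs

  StartSet : List (List (Fin n)) → Subset n → Set
  StartSet qs Z = ∀ x → x ∈ Z ⇔ Any (λ q → head q ≡ just x) qs

{-# OPTIONS --safe #-}
module Submission where

-- A minimum path cover is obtained from a minimum zero forcing set by recording its forcing chains.
-- Conversely every cover by induced paths of a block-cycle graph can be oriented so that each path
-- is a forcing chain.  Add the paths one at a time, each adjacent to the set U of vertices covered so
-- far whenever possible; then U is connected inside each component of the graph that it meets.  No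
-- vertex v has three neighbours in one component of G − v, for they would lie with v in one block;
-- hence at most two edges au and bv join a new path p to U.  If v is forced no earlier than u in a
-- schedule for U, orient p so that a comes no later than b: run p up to a, then the schedule for U
-- until v is black, then the rest of p, then the rest of the schedule.

open import Defs
open import Data.Nat using (ℕ; zero; suc; _+_; _≤_; _<_; z≤n; s≤s; _≤?_; _<?_)
open import Data.Nat.Properties
open import Data.Fin using (Fin; zero; suc; toℕ)
import Data.Fin.Properties as Finₚ
open import Data.Fin.Subset using (Subset; ⊤; ⁅_⁆; _∪_; _-_; ∣_∣; inside; outside; _⊆_)
  renaming (_∈_ to _∈ₛ_; _∉_ to _∉ₛ_; ⊥ to ∅)
open import Data.Fin.Subset.Properties hiding (_∈?_)
import Data.Fin.Subset.Properties as Subsetₚ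
open import Data.Vec using (here; there; []; _∷_)
open import Data.List
  using (List; []; _∷_; _++_; length; lookup; concat; allFin; reverse; head; [_]; map; initLast; _∷ʳ′_)
open import Data.List.Properties
  using (++-assoc; ++-identityʳ; concat-map-[_]; unfold-reverse; length-map; reverse-involutive)
open import Data.List.Relation.Unary.Any using (Any; here; there; any?)
import Data.List.Relation.Unary.Any as Any
import Data.List.Relation.Unary.Any.Properties as Anyₚ
open import Data.List.Relation.Unary.All using (All; []; _∷_)
import Data.List.Relation.Unary.All as All
import Data.List.Relation.Unary.All.Properties as Allₚ
open import Data.List.Relation.Unary.AllPairs using ([]; _∷_)
open import Data.List.Relation.Unary.Unique.Propositional using (Unique)
import Data.List.Relation.Unary.Unique.Propositional.Properties as Uniqueₚ
open import Data.List.Relation.Binary.Pointwise using (Pointwise; []; _∷_; Pointwise-length)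
open import Data.List.Relation.Binary.Permutation.Propositional
  using (_↭_; refl; prep; swap; trans; ↭-sym; ↭-trans; ↭⇒↭ₛ)
open import Data.List.Relation.Binary.Permutation.Propositional.Properties
  using (↭-empty-inv; ∈-resp-↭; Any-resp-↭; All-resp-↭; ↭-length; ↭-reverse; shift; shifts; ++⁺ˡ; ++⁺)
import Data.List.Relation.Binary.Permutation.Setoid.Properties as Permₛ
open import Data.List.Relation.Binary.BagAndSetEquality using (∼bag⇒↭)
open import Data.List.Membership.Propositional using (_∈_; _∉_; find; lose)
open import Data.List.Membership.Propositional.Properties
open import Data.List.Membership.Propositional.Properties.WithK using (unique∧set⇒bag)
open import Data.Product using (Σ; ∃; ∃₂; ∃-syntax; _×_; _,_; proj₁; proj₂)
import Data.Product.Properties as Productₚ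
open import Data.Sum using (_⊎_; inj₁; inj₂; [_,_]′)
import Data.Sum as Sum
open import Data.Empty using (⊥; ⊥-elim)
open import Data.Bool using (true)
import Data.Bool.Properties as Boolₚ
open import Data.Maybe using (just)
open import Data.Unit using (tt) renaming (⊤ to Unit)
open import Relation.Nullary using (¬_; Dec; yes; no; contradiction; ¬?; _×-dec_; _→-dec_)
open import Relation.Nullary.Decidable using (decidable-stable)
open import Relation.Binary.PropositionalEquality
  using (_≡_; _≢_; refl; ≢-sym; cong; subst; setoid)
  renaming (sym to ≡-sym; trans to ≡-trans)
open import Function using (_∘_; id; case_of_)
open import Function.Bundles using (_⇔_; mk⇔; Equivalence)
open Equivalence using (to; from)

-- Lists

-- The obstacle is a circular wait: a vertex may force its successor only after its neighbours on
-- other paths are black, and these may be waiting in turn. Adding the paths one at a time reduces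
-- the question to the edges between one new path p and U. Connectedness of U inside components is
-- what bounds their number: sort three such edges by their ends on p; the middle end y then has
-- three distinct neighbours from which U is reached without passing through y, and U joins them up
-- in G - y. If the edges led to separate pieces of U, p could have any number of them. A schedule
-- is stored as a rank, a time for each vertex, and not as a list of forces. Interleaving two
-- schedules then only shifts numbers, and the list is recovered at the very end by always forcing
-- the white vertex of least rank. The common value of both numbers is the least size of a zero
-- forcing set; finding it is a finite search, which rests on zero forcing being decidable.

data Step {A : Set} (x y : A) : List A → Set where
  here  : ∀ {zs} → Step x y (x ∷ y ∷ zs)
  there : ∀ {z zs} → Step x y zs → Step x y (z ∷ zs)

module _ {A : Set} where

  ∉-head : ∀ {x : A} {xs} → Unique (x ∷ xs) → x ∉ xs
  ∉-head = Uniqueₚ.Unique[x∷xs]⇒x∉xs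

  unique-++⁻ : ∀ (xs : List A) {ys} → Unique (xs ++ ys) →
               Unique xs × Unique ys × (∀ {x} → x ∈ xs → x ∉ ys)
  unique-++⁻ [] u = [] , u , λ ()
  unique-++⁻ (x ∷ xs) (x∉ ∷ u) with unique-++⁻ xs u
  ... | uxs , uys , disj = Allₚ.++⁻ˡ xs x∉ ∷ uxs , uys , λ where
    (here refl) x∈ys → All.lookup (Allₚ.++⁻ʳ xs x∉) x∈ys refl
    (there x∈xs) → disj x∈xs

  unique-↭ : ∀ {xs ys : List A} → xs ↭ ys → Unique xs → Unique ys
  unique-↭ p = Permₛ.Unique-resp-↭ (setoid A) (↭⇒↭ₛ p)

  unique-∷⁺ : ∀ {x : A} {xs} → x ∉ xs → Unique xs → Unique (x ∷ xs)
  unique-∷⁺ x∉ u = Allₚ.¬Any⇒All¬ _ x∉ ∷ u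

  unique-set⇒↭ : ∀ {xs ys : List A} → Unique xs → Unique ys →
                 (∀ {x} → x ∈ xs → x ∈ ys) → (∀ {x} → x ∈ ys → x ∈ xs) → xs ↭ ys
  unique-set⇒↭ ux uy f g = ∼bag⇒↭ (unique∧set⇒bag ux uy (mk⇔ f g))

  concat-↭ : ∀ {xss yss : List (List A)} → xss ↭ yss → concat xss ↭ concat yss
  concat-↭ refl = refl
  concat-↭ (prep xs p) = ++⁺ˡ xs (concat-↭ p)
  concat-↭ (swap xs ys p) = ↭-trans (shifts xs ys) (++⁺ˡ ys (++⁺ˡ xs (concat-↭ p)))
  concat-↭ (trans p q) = ↭-trans (concat-↭ p) (concat-↭ q)

  -- Paths are oriented in the order in which they are added, whereas `Orientation` refers to the
  -- order of the given cover; this carries the choice back.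
  pointwise-↭ : ∀ {R : A → A → Set} {xs xs′ ys′} → xs ↭ xs′ → Pointwise R xs′ ys′ →
                ∃ λ ys → Pointwise R xs ys × ys ↭ ys′
  pointwise-↭ refl pw = _ , pw , refl
  pointwise-↭ (prep x p) (r ∷ pw) with pointwise-↭ p pw
  ... | ys , pw′ , q = _ ∷ ys , r ∷ pw′ , prep _ q
  pointwise-↭ (swap x y p) (r ∷ s ∷ pw) with pointwise-↭ p pw
  ... | ys , pw′ , q = _ ∷ _ ∷ ys , s ∷ r ∷ pw′ , swap _ _ q
  pointwise-↭ (trans p p′) pw with pointwise-↭ p′ pw
  ... | ys , pw′ , q with pointwise-↭ p pw′
  ... | zs , pw″ , q′ = zs , pw″ , ↭-trans q′ q

  ∈⇒↭∷ : ∀ {x : A} {xs} → x ∈ xs → ∃ λ ys → xs ↭ x ∷ ys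
  ∈⇒↭∷ x∈xs with ∈-∃++ x∈xs
  ... | ys , zs , refl = ys ++ zs , shift _ ys zs

  unique-concat⇒≡ : ∀ (xss : List (List A)) → Unique (concat xss) →
    ∀ {x xs ys} → x ∈ xs → xs ∈ xss → x ∈ ys → ys ∈ xss → xs ≡ ys
  unique-concat⇒≡ (zs ∷ xss) u x∈xs xs∈ x∈ys ys∈ with unique-++⁻ zs u
  unique-concat⇒≡ (zs ∷ xss) u x∈xs (here refl) x∈ys (here refl) | _ = refl
  unique-concat⇒≡ (zs ∷ xss) u x∈xs (here refl) x∈ys (there ys∈) | _ , _ , disj =
    contradiction (∈-concat⁺′ x∈ys ys∈) (disj x∈xs)
  unique-concat⇒≡ (zs ∷ xss) u x∈xs (there xs∈) x∈ys (here refl) | _ , _ , disj =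
    contradiction (∈-concat⁺′ x∈xs xs∈) (disj x∈ys)
  unique-concat⇒≡ (zs ∷ xss) u x∈xs (there xs∈) x∈ys (there ys∈) | _ , u′ , _ =
    unique-concat⇒≡ xss u′ x∈xs xs∈ x∈ys ys∈

  unique-member : ∀ (xss : List (List A)) → Unique (concat xss) → ∀ {xs} → xs ∈ xss → Unique xs
  unique-member (zs ∷ xss) u (here refl) = proj₁ (unique-++⁻ zs u)
  unique-member (zs ∷ xss) u (there xs∈) = unique-member xss (proj₁ (proj₂ (unique-++⁻ zs u))) xs∈

  step-∈ˡ : ∀ {x y : A} {zs} → Step x y zs → x ∈ zs
  step-∈ˡ here = here refl
  step-∈ˡ (there s) = there (step-∈ˡ s)

  step-∈ʳ : ∀ {x y : A} {zs} → Step x y zs → y ∈ zs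
  step-∈ʳ here = there (here refl)
  step-∈ʳ (there s) = there (step-∈ʳ s)

  step-++ˡ : ∀ {x y : A} {xs} ys → Step x y xs → Step x y (xs ++ ys)
  step-++ˡ ys here = here
  step-++ˡ ys (there s) = there (step-++ˡ ys s)

  step-++ʳ : ∀ {x y : A} xs {ys} → Step x y ys → Step x y (xs ++ ys)
  step-++ʳ [] s = s
  step-++ʳ (x ∷ xs) s = there (step-++ʳ xs s)

  step-reverse : ∀ {x y : A} {zs} → Step x y zs → Step y x (reverse zs)
  step-reverse {x} {y} (here {zs})
    rewrite unfold-reverse x (y ∷ zs) | unfold-reverse y zs | ++-assoc (reverse zs) [ y ] [ x ] =
    step-++ʳ (reverse zs) here
  step-reverse (there {z} {zs} s) rewrite unfold-reverse z zs = step-++ˡ [ z ] (step-reverse s)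

  step-tail-∈ʳ : ∀ {x y z : A} {zs} → Step x y (z ∷ zs) → y ∈ zs
  step-tail-∈ʳ here = here refl
  step-tail-∈ʳ (there s) = step-∈ʳ s

  step-functional : ∀ {x y y′ : A} {zs} → Unique zs → Step x y zs → Step x y′ zs → y ≡ y′
  step-functional u here here = refl
  step-functional u here (there t) = contradiction (step-∈ˡ t) (∉-head u)
  step-functional u (there s) here = contradiction (step-∈ˡ s) (∉-head u)
  step-functional (_ ∷ u) (there s) (there t) = step-functional u s t

  step-injective : ∀ {x x′ y : A} {zs} → Unique zs → Step x y zs → Step x′ y zs → x ≡ x′
  step-injective u here here = refl
  step-injective (_ ∷ u) here (there t) = contradiction (step-tail-∈ʳ t) (∉-head u)
  step-injective (_ ∷ u) (there s) here = contradiction (step-tail-∈ʳ s) (∉-head u)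
  step-injective (_ ∷ u) (there s) (there t) = step-injective u s t

  step-asym : ∀ {x y : A} {zs} → Unique zs → Step x y zs → ¬ Step y x zs
  step-asym u here t = ∉-head u (step-tail-∈ʳ t)
  step-asym u (there s) here = ∉-head u (step-∈ʳ s)
  step-asym (_ ∷ u) (there s) (there t) = step-asym u s t

  head-no-pred : ∀ {x y : A} {zs} → Unique (y ∷ zs) → ¬ Step x y (y ∷ zs)
  head-no-pred u s = ∉-head u (step-tail-∈ʳ s)

  step-lookup⁺ : ∀ {x y : A} {zs} → Step x y zs →
                 ∃₂ λ i j → lookup zs i ≡ x × lookup zs j ≡ y × toℕ j ≡ suc (toℕ i)
  step-lookup⁺ here = zero , suc zero , refl , refl , refl
  step-lookup⁺ (there s) with step-lookup⁺ s
  ... | i , j , p , q , e = suc i , suc j , p , q , cong suc e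

  step-lookup⁻ : ∀ (zs : List A) i j → toℕ j ≡ suc (toℕ i) → Step (lookup zs i) (lookup zs j) zs
  step-lookup⁻ (z ∷ z′ ∷ zs) zero (suc zero) e = here
  step-lookup⁻ (z ∷ zs) (suc i) (suc j) e = there (step-lookup⁻ zs i j (suc-injective e))

  has-pred : ∀ {y z : A} {zs} → y ∈ zs → ∃ λ x → Step x y (z ∷ zs)
  has-pred (here refl) = _ , here
  has-pred (there y∈) with has-pred y∈
  ... | x , s = x , there s

  step-suffix : ∀ {x y : A} ys {zs} → Unique (ys ++ x ∷ zs) → Step x y (ys ++ x ∷ zs) →
                ∃ λ zs′ → zs ≡ y ∷ zs′
  step-suffix [] u here = _ , refl
  step-suffix [] u (there s) = contradiction (step-∈ˡ s) (∉-head u)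
  step-suffix (_ ∷ []) u here = contradiction (here refl) (∉-head u)
  step-suffix (_ ∷ _ ∷ ys) u here =
    contradiction (there (∈-++⁺ʳ ys (here refl))) (∉-head u)
  step-suffix (_ ∷ ys) (_ ∷ u) (there s) = step-suffix ys u s

-- Positions of vertices in a list

module _ {n : ℕ} where

  open import Data.List.Membership.DecPropositional (Finₚ._≟_ {n}) public using (_∈?_)

  -- The length of the list if x does not occur in it.
  position : Fin n → List (Fin n) → ℕ
  position x [] = 0
  position x (y ∷ ys) with x Finₚ.≟ y
  ... | yes _ = 0
  ... | no _ = suc (position x ys)

  position-head : ∀ x {ys} → position x (x ∷ ys) ≡ 0
  position-head x with x Finₚ.≟ x
  ... | yes _ = refl
  ... | no ¬p = contradiction refl ¬p

  position-tail : ∀ {x y ys} → x ≢ y → position x (y ∷ ys) ≡ suc (position x ys)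
  position-tail {x} {y} x≢y with x Finₚ.≟ y
  ... | yes p = contradiction p x≢y
  ... | no _ = refl

  position≤length : ∀ x ys → position x ys ≤ length ys
  position≤length x [] = z≤n
  position≤length x (y ∷ ys) with x Finₚ.≟ y
  ... | yes _ = z≤n
  ... | no _ = s≤s (position≤length x ys)

  position-++-∈ : ∀ {x xs} ys → x ∈ xs → position x (xs ++ ys) < length xs
  position-++-∈ {x} {z ∷ xs} ys x∈ with x Finₚ.≟ z | x∈
  ... | yes _ | _ = s≤s z≤n
  ... | no x≢z | here p = contradiction p x≢z
  ... | no _ | there x∈′ = s≤s (position-++-∈ ys x∈′)

  position-++-≡ : ∀ {x xs} ys → x ∈ xs → position x (xs ++ ys) ≡ position x xs
  position-++-≡ {x} {z ∷ xs} ys x∈ with x Finₚ.≟ z | x∈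
  ... | yes _ | _ = refl
  ... | no x≢z | here p = contradiction p x≢z
  ... | no _ | there x∈′ = cong suc (position-++-≡ ys x∈′)

  position-++-∉ : ∀ {x} xs ys → x ∉ xs → length xs ≤ position x (xs ++ ys)
  position-++-∉ [] ys x∉ = z≤n
  position-++-∉ {x} (z ∷ xs) ys x∉ with x Finₚ.≟ z
  ... | yes p = contradiction (here p) x∉
  ... | no _ = s≤s (position-++-∉ xs ys (x∉ ∘ there))

  position-step : ∀ {x y zs} → Unique zs → Step x y zs → position y zs ≡ suc (position x zs)
  position-step {x} {y} {_ ∷ _ ∷ zs} u here
    rewrite position-head x {y ∷ zs} | position-tail {ys = y ∷ zs} (λ e → ∉-head u (here (≡-sym e))) =
    cong suc (position-head y)
  position-step {x} {y} {z ∷ zs} u@(_ ∷ u′) (there s)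
    rewrite position-tail {x} {z} {zs} (λ e → ∉-head u (subst (_∈ zs) e (step-∈ˡ s)))
          | position-tail {y} {z} {zs} (λ e → ∉-head u (subst (_∈ zs) e (step-∈ʳ s))) =
    cong suc (position-step u′ s)

  position-injective : ∀ {x y zs} → x ∈ zs → position x zs ≡ position y zs → x ≡ y
  position-injective {x} {y} {z ∷ zs} x∈ e with x Finₚ.≟ z | y Finₚ.≟ z
  ... | yes p | yes q = ≡-trans p (≡-sym q)
  ... | no x≢z | no _ with x∈
  ...   | here p = contradiction p x≢z
  ...   | there x∈′ = position-injective x∈′ (suc-injective e)

  position-reverse : ∀ {x y zs} → Unique zs → x ∈ zs → y ∈ zs →
    position x zs ≤ position y zs ⊎ position x (reverse zs) ≤ position y (reverse zs)
  position-reverse {x} {y} {z ∷ zs} u@(_ ∷ u′) x∈ y∈ with x Finₚ.≟ z | y Finₚ.≟ z | x∈ | y∈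
  ... | yes _ | _ | _ | _ = inj₁ z≤n
  ... | no x≢z | _ | here p | _ = contradiction p x≢z
  ... | no _ | no y≢z | there _ | here p = contradiction p y≢z
  -- Here `y` is the head, so after reversal it comes behind all of `zs`, where `x` lies.
  ... | no _ | yes refl | there x∈′ | _ rewrite unfold-reverse z zs =
    inj₂ (<⇒≤ (<-≤-trans (position-++-∈ [ z ] (∈-resp-↭ (↭-sym (↭-reverse zs)) x∈′))
      (position-++-∉ (reverse zs) [ z ] (∉-head u ∘ ∈-resp-↭ (↭-reverse zs)))))
  ... | no _ | no _ | there x∈′ | there y∈′ with position-reverse u′ x∈′ y∈′
  ...   | inj₁ le = inj₁ (s≤s le)
  ...   | inj₂ le rewrite unfold-reverse z zs
            | position-++-≡ [ z ] (∈-resp-↭ (↭-sym (↭-reverse zs)) x∈′)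
            | position-++-≡ [ z ] (∈-resp-↭ (↭-sym (↭-reverse zs)) y∈′) = inj₂ le

-- Blocks

x∉p-x : ∀ {n} (x : Fin n) (p : Subset n) → x ∉ₛ p - x
x∉p-x zero (s ∷ p) ()
x∉p-x (suc x) (inside ∷ p) (there h) = x∉p-x x p h
x∉p-x (suc x) (outside ∷ p) (there h) = x∉p-x x p h

x∈p-y⇒x≢y : ∀ {n} {x y : Fin n} {p} → x ∈ₛ p - y → x ≢ y
x∈p-y⇒x≢y {p = p} h refl = x∉p-x _ p h

∣B∣<∣B∪v∣ : ∀ {n} {B : Subset n} {v} → v ∉ₛ B → ∣ B ∣ < ∣ B ∪ ⁅ v ⁆ ∣
∣B∣<∣B∪v∣ {B = B} {v} v∉B =
  p⊂q⇒∣p∣<∣q∣ (p⊆p∪q ⁅ v ⁆ , v , q⊆p∪q B ⁅ v ⁆ (x∈⁅x⁆ v) , v∉B)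

∈-∪⁅⁆⁻ : ∀ {n} {B : Subset n} {x v} → x ∈ₛ B ∪ ⁅ v ⁆ → x ∈ₛ B ⊎ x ≡ v
∈-∪⁅⁆⁻ {B = B} {v = v} h = Sum.map₂ (x∈⁅y⁆⇒x≡y v) (x∈p∪q⁻ B ⁅ v ⁆ h)

pigeonhole₃ : ∀ {A : Set} {x y z : A} {P Q : A → Set} →
  (∀ {a b} → P a → P b → a ≡ b) → (∀ {a b} → Q a → Q b → a ≡ b) →
  x ≢ y → y ≢ z → x ≢ z → P x ⊎ Q x → P y ⊎ Q y → P z ⊎ Q z → ⊥
pigeonhole₃ p q x≢y y≢z x≢z (inj₁ a) (inj₁ b) _ = x≢y (p a b)
pigeonhole₃ p q x≢y y≢z x≢z (inj₁ a) (inj₂ b) (inj₁ c) = x≢z (p a c)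
pigeonhole₃ p q x≢y y≢z x≢z (inj₁ a) (inj₂ b) (inj₂ c) = y≢z (q b c)
pigeonhole₃ p q x≢y y≢z x≢z (inj₂ a) (inj₂ b) _ = x≢y (q a b)
pigeonhole₃ p q x≢y y≢z x≢z (inj₂ a) (inj₁ b) (inj₁ c) = y≢z (p b c)
pigeonhole₃ p q x≢y y≢z x≢z (inj₂ a) (inj₁ b) (inj₂ c) = x≢z (q a c)

module _ {n : ℕ} (G : Graph n) where

  adj-sym : ∀ {x y} → Adj G x y → Adj G y x
  adj-sym {x} {y} a = ≡-trans (Graph.sym G y x) a

  adj-≢ : ∀ {x y} → Adj G x y → x ≢ y
  adj-≢ {x} a refl with ≡-trans (≡-sym a) (irrefl G x)
  ... | ()

  walkIn-⊆ : ∀ {S T : Subset n} {x y} → S ⊆ T → WalkIn G S x y → WalkIn G T x y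
  walkIn-⊆ S⊆T (here x∈) = here (S⊆T x∈)
  walkIn-⊆ S⊆T (step x∈ a w) = step (S⊆T x∈) a (walkIn-⊆ S⊆T w)

  walkIn-trans : ∀ {S : Subset n} {x y z} → WalkIn G S x y → WalkIn G S y z → WalkIn G S x z
  walkIn-trans (here _) w′ = w′
  walkIn-trans (step x∈ a w) w′ = step x∈ a (walkIn-trans w w′)

  walkIn-start : ∀ {S : Subset n} {x y} → WalkIn G S x y → x ∈ₛ S
  walkIn-start (here x∈) = x∈
  walkIn-start (step x∈ _ _) = x∈

  walkIn-end : ∀ {S : Subset n} {x y} → WalkIn G S x y → y ∈ₛ S
  walkIn-end (here x∈) = x∈
  walkIn-end (step _ _ w) = walkIn-end w

  walkIn-sym : ∀ {S : Subset n} {x y} → WalkIn G S x y → WalkIn G S y x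
  walkIn-sym (here x∈) = here x∈
  walkIn-sym (step x∈ a w) =
    walkIn-trans (walkIn-sym w) (step (walkIn-start w) (adj-sym a) (here x∈))

  connected-from : ∀ {S : Subset n} {r} → (∀ {x} → x ∈ₛ S → WalkIn G S x r) → ConnectedOn G S
  connected-from h x y x∈ y∈ = walkIn-trans (h x∈) (walkIn-sym (h y∈))

  connected-minus : ∀ {S : Subset n} → NonSeparable G S → ∀ w → ConnectedOn G (S - w)
  connected-minus {S} (_ , conn , cut) w with w Subsetₚ.∈? S
  ... | yes w∈ = cut w w∈
  ... | no w∉ = λ x y x∈ y∈ → walkIn-⊆
    (λ z∈ → x∈p∧x≢y⇒x∈p-y z∈ λ { refl → w∉ z∈ })
    (conn x y (p─q⊆p S _ x∈) (p─q⊆p S _ y∈))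

  -- Whichever vertex is deleted, `a` or `b` survives, and the survivor is a hub that both halves
  -- still reach.
  nonseparable-∪ : ∀ {S T : Subset n} {a b} → NonSeparable G S → NonSeparable G T → a ≢ b →
    a ∈ₛ S → b ∈ₛ S → a ∈ₛ T → b ∈ₛ T → NonSeparable G (S ∪ T)
  nonseparable-∪ {S} {T} {a} {b} nsS nsT a≢b a∈S b∈S a∈T b∈T =
    (a , S⊆ a∈S) , connected-from toA , λ w _ → connected-from (toHub w (hub w))
    where
    S⊆ : S ⊆ S ∪ T
    S⊆ = p⊆p∪q T
    T⊆ : T ⊆ S ∪ T
    T⊆ = q⊆p∪q S T
    toA : ∀ {x} → x ∈ₛ S ∪ T → WalkIn G (S ∪ T) x a
    toA {x} x∈ with x∈p∪q⁻ S T x∈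
    ... | inj₁ x∈S = walkIn-⊆ S⊆ (proj₁ (proj₂ nsS) x a x∈S a∈S)
    ... | inj₂ x∈T = walkIn-⊆ T⊆ (proj₁ (proj₂ nsT) x a x∈T a∈T)
    hub : ∀ w → ∃ λ h → h ≢ w × h ∈ₛ S × h ∈ₛ T
    hub w with a Finₚ.≟ w
    ... | no a≢w = a , a≢w , a∈S , a∈T
    ... | yes refl = b , ≢-sym a≢b , b∈S , b∈T
    minus-⊆ : ∀ {P Q : Subset n} {w} → P ⊆ Q → P - w ⊆ Q - w
    minus-⊆ {P} P⊆Q h = x∈p∧x≢y⇒x∈p-y (P⊆Q (p─q⊆p P _ h)) (x∈p-y⇒x≢y h)
    toHub : ∀ w → (h : ∃ λ h → h ≢ w × h ∈ₛ S × h ∈ₛ T) →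
            ∀ {x} → x ∈ₛ (S ∪ T) - w → WalkIn G ((S ∪ T) - w) x (proj₁ h)
    toHub w (h , h≢w , h∈S , h∈T) {x} x∈ with x∈p∪q⁻ S T (p─q⊆p (S ∪ T) _ x∈)
    ... | inj₁ x∈S = walkIn-⊆ (minus-⊆ S⊆) (connected-minus nsS w x h
            (x∈p∧x≢y⇒x∈p-y x∈S (x∈p-y⇒x≢y x∈)) (x∈p∧x≢y⇒x∈p-y h∈S h≢w))
    ... | inj₂ x∈T = walkIn-⊆ (minus-⊆ T⊆) (connected-minus nsT w x h
            (x∈p∧x≢y⇒x∈p-y x∈T (x∈p-y⇒x≢y x∈)) (x∈p∧x≢y⇒x∈p-y h∈T h≢w))

  -- Simplicity is built into the index: each vertex is deleted from the set that the rest of the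
  -- path may use.
  data SimplePath : Subset n → Fin n → Fin n → Set where
    stop : ∀ {S x} → x ∈ₛ S → SimplePath S x x
    go   : ∀ {S x y z} → x ∈ₛ S → Adj G x y → SimplePath (S - x) y z → SimplePath S x z

  -- Loop erasure: cut a walk at its last visit to x.
  last-visit : ∀ {S : Subset n} {x a b} → WalkIn G S a b →
    WalkIn G (S - x) a b ⊎ x ≡ b ⊎ ∃ λ x′ → Adj G x x′ × WalkIn G (S - x) x′ b
  last-visit {x = x} (here {a} a∈) with a Finₚ.≟ x
  ... | yes refl = inj₂ (inj₁ refl)
  ... | no a≢x = inj₁ (here (x∈p∧x≢y⇒x∈p-y a∈ a≢x))
  last-visit {x = x} (step {a} a∈ adj w) with last-visit {x = x} w
  ... | inj₂ later = inj₂ later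
  ... | inj₁ w′ with a Finₚ.≟ x
  ...   | yes refl = inj₂ (inj₂ (_ , adj , w′))
  ...   | no a≢x = inj₁ (step (x∈p∧x≢y⇒x∈p-y a∈ a≢x) adj w′)

  simplePath : ∀ k {S : Subset n} {x y} → ∣ S ∣ ≤ k → WalkIn G S x y → SimplePath S x y
  simplePath k {S} {x} S≤k w with last-visit {x = x} w
  ... | inj₁ w′ = contradiction (walkIn-start w′) (x∉p-x x S)
  ... | inj₂ (inj₁ refl) = stop (walkIn-start w)
  simplePath zero S≤k w | inj₂ (inj₂ (x′ , a , w′)) =
    contradiction (<-≤-trans (x∈p⇒∣p-x∣<∣p∣ (walkIn-start w)) S≤k) λ ()
  simplePath (suc k) S≤k w | inj₂ (inj₂ (x′ , a , w′)) = go (walkIn-start w) a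
    (simplePath k (≤-pred (<-≤-trans (x∈p⇒∣p-x∣<∣p∣ (walkIn-start w)) S≤k)) w′)

  verts : ∀ {S x y} → SimplePath S x y → Subset n
  verts (stop {x = x} _) = ⁅ x ⁆
  verts (go {x = x} _ _ π) = ⁅ x ⁆ ∪ verts π

  verts-⊆ : ∀ {S x y} (π : SimplePath S x y) → verts π ⊆ S
  verts-⊆ (stop {x = x} x∈) h rewrite x∈⁅y⁆⇒x≡y x h = x∈
  verts-⊆ {S} (go {x = x} x∈ _ π) h with x∈p∪q⁻ ⁅ x ⁆ (verts π) h
  ... | inj₁ h′ rewrite x∈⁅y⁆⇒x≡y x h′ = x∈
  ... | inj₂ h′ = p─q⊆p S _ (verts-⊆ π h′)

  verts-start : ∀ {S x y} (π : SimplePath S x y) → x ∈ₛ verts π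
  verts-start (stop {x = x} _) = x∈⁅x⁆ x
  verts-start (go {x = x} _ _ π) = p⊆p∪q (verts π) (x∈⁅x⁆ x)

  verts-end : ∀ {S x y} (π : SimplePath S x y) → y ∈ₛ verts π
  verts-end (stop {x = x} _) = x∈⁅x⁆ x
  verts-end (go {x = x} _ _ π) = q⊆p∪q ⁅ x ⁆ (verts π) (verts-end π)

  toEnd : ∀ {S x y z} (π : SimplePath S x y) → z ∈ₛ verts π → WalkIn G (verts π) z y
  toEnd (stop {x = x} _) h rewrite x∈⁅y⁆⇒x≡y x h = here (x∈⁅x⁆ x)
  toEnd (go {x = x} _ a π) h with x∈p∪q⁻ ⁅ x ⁆ (verts π) h
  ... | inj₂ h′ = walkIn-⊆ (q⊆p∪q ⁅ x ⁆ (verts π)) (toEnd π h′)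
  ... | inj₁ h′ rewrite x∈⁅y⁆⇒x≡y x h′ = step (p⊆p∪q (verts π) (x∈⁅x⁆ x)) a
    (walkIn-⊆ (q⊆p∪q ⁅ x ⁆ (verts π)) (toEnd π (verts-start π)))

  -- Deleting `w` leaves at most two pieces of the path, and each of them keeps an end. When both
  -- ends are adjacent to a further vertex, the pieces are reunited there.
  toAnEnd : ∀ {S x y w z} (π : SimplePath S x y) → z ∈ₛ verts π → z ≢ w →
    WalkIn G (verts π - w) z x ⊎ WalkIn G (verts π - w) z y
  toAnEnd (stop {x = x} _) h z≢w rewrite x∈⁅y⁆⇒x≡y x h = inj₁ (here (x∈p∧x≢y⇒x∈p-y (x∈⁅x⁆ x) z≢w))
  toAnEnd {S} {w = w} (go {x = x} _ a π) h z≢w with x∈p∪q⁻ ⁅ x ⁆ (verts π) h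
  ... | inj₁ h′ rewrite x∈⁅y⁆⇒x≡y x h′ =
    inj₁ (here (x∈p∧x≢y⇒x∈p-y (p⊆p∪q (verts π) (x∈⁅x⁆ x)) z≢w))
  ... | inj₂ h′ with x Finₚ.≟ w
  ...   | yes refl = inj₂ (walkIn-⊆
            (λ t → x∈p∧x≢y⇒x∈p-y (q⊆p∪q ⁅ x ⁆ (verts π) t) (x∈p-y⇒x≢y (verts-⊆ π t)))
            (toEnd π h′))
  ...   | no x≢w = Sum.map extend (walkIn-⊆ widen) (toAnEnd π h′ z≢w)
    where
    widen : ∀ {t} → t ∈ₛ verts π - w → t ∈ₛ (⁅ x ⁆ ∪ verts π) - w
    widen t = x∈p∧x≢y⇒x∈p-y (q⊆p∪q ⁅ x ⁆ (verts π) (p─q⊆p (verts π) _ t)) (x∈p-y⇒x≢y t)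
    extend : ∀ {z} → WalkIn G (verts π - w) z _ → WalkIn G ((⁅ x ⁆ ∪ verts π) - w) z x
    extend ω = walkIn-trans (walkIn-⊆ widen ω)
      (step (widen (walkIn-end ω)) (adj-sym a)
        (here (x∈p∧x≢y⇒x∈p-y (p⊆p∪q (verts π) (x∈⁅x⁆ x)) x≢w)))

  -- Loop erasure turns the walk into a simple path, which `v` closes to a cycle. Without `v` the
  -- path remains; without any other vertex, every remaining one reaches an end of the path and from
  -- there `v`.
  cycle-nonseparable : ∀ {v x y} → Adj G v x → Adj G v y → WalkIn G (⊤ - v) x y →
    ∃ λ S → NonSeparable G S × v ∈ₛ S × x ∈ₛ S × y ∈ₛ S
  cycle-nonseparable {v} {x} {y} vx vy ω =
    S , ((v , v∈S) , connected-from toV , cut) , v∈S , V⊆S (verts-start π) , V⊆S (verts-end π)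
    where
    π : SimplePath (⊤ - v) x y
    π = simplePath _ ≤-refl ω
    S : Subset n
    S = ⁅ v ⁆ ∪ verts π
    v∈S : v ∈ₛ S
    v∈S = p⊆p∪q (verts π) (x∈⁅x⁆ v)
    V⊆S : verts π ⊆ S
    V⊆S = q⊆p∪q ⁅ v ⁆ (verts π)
    V≢v : ∀ {z} → z ∈ₛ verts π → z ≢ v
    V≢v h = x∈p-y⇒x≢y (verts-⊆ π h)
    toV : ∀ {z} → z ∈ₛ S → WalkIn G S z v
    toV z∈ with x∈p∪q⁻ ⁅ v ⁆ (verts π) z∈
    ... | inj₁ h rewrite x∈⁅y⁆⇒x≡y v h = here v∈S
    ... | inj₂ h = walkIn-trans (walkIn-⊆ V⊆S (toEnd π h))
                     (step (V⊆S (verts-end π)) (adj-sym vy) (here v∈S))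
    cut : ∀ w → w ∈ₛ S → ConnectedOn G (S - w)
    cut w w∈ with v Finₚ.≟ w
    ... | yes refl = connected-from {r = y} λ {z} z∈ →
      [ (λ h → contradiction (x∈⁅y⁆⇒x≡y v h) (x∈p-y⇒x≢y z∈))
      , (λ h → walkIn-⊆ (λ t → x∈p∧x≢y⇒x∈p-y (V⊆S t) (V≢v t)) (toEnd π h))
      ]′ (x∈p∪q⁻ ⁅ v ⁆ (verts π) (p─q⊆p S _ z∈))
    ... | no v≢w = connected-from toV′
      where
      v∈ : v ∈ₛ S - w
      v∈ = x∈p∧x≢y⇒x∈p-y v∈S v≢w
      widen : verts π - w ⊆ S - w
      widen t = x∈p∧x≢y⇒x∈p-y (V⊆S (p─q⊆p (verts π) _ t)) (x∈p-y⇒x≢y t)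
      finish : ∀ {z e} → Adj G v e → WalkIn G (verts π - w) z e → WalkIn G (S - w) z v
      finish a ω′ = walkIn-trans (walkIn-⊆ widen ω′)
                      (step (widen (walkIn-end ω′)) (adj-sym a) (here v∈))
      toV′ : ∀ {z} → z ∈ₛ S - w → WalkIn G (S - w) z v
      toV′ z∈ with x∈p∪q⁻ ⁅ v ⁆ (verts π) (p─q⊆p S _ z∈)
      ... | inj₁ h rewrite x∈⁅y⁆⇒x≡y v h = here v∈
      ... | inj₂ h = [ finish vx , finish vy ]′ (toAnEnd π h (x∈p-y⇒x≢y z∈))

  -- Degrees inside blocks and non-separable sets

  edge-no-three : ∀ {S : Subset n} → IsEdgeOn G S → ∀ {x y z} → x ∈ₛ S → y ∈ₛ S → z ∈ₛ S →
    x ≢ y → y ≢ z → x ≢ z → ⊥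
  edge-no-three (u , v , _ , _ , h) x∈ y∈ z∈ x≢y y≢z x≢z =
    pigeonhole₃ {P = _≡ u} {Q = _≡ v} (λ { refl refl → refl }) (λ { refl refl → refl })
      x≢y y≢z x≢z (to (h _) x∈) (to (h _) y∈) (to (h _) z∈)

  -- An index has one cyclic successor and one cyclic predecessor, wrap-around included, so two of
  -- three neighbours must coincide.
  cycle-degree : ∀ {S : Subset n} → IsCycleOn G S → ∀ {v x y z} →
    v ∈ₛ S → x ∈ₛ S → y ∈ₛ S → z ∈ₛ S → x ≢ y → y ≢ z → x ≢ z →
    Adj G v x → Adj G v y → Adj G v z → ⊥
  cycle-degree (c , _ , _ , ∈c , adj⇔) {v} v∈ x∈ y∈ z∈ x≢y y≢z x≢z vx vy vz
    with Any.index (to (∈c _) v∈) | Anyₚ.lookup-index (to (∈c _) v∈)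
  ... | i | refl =
    pigeonhole₃ {P = Next} {Q = Prev} next-unique prev-unique x≢y y≢z x≢z
      (nbr x∈ vx) (nbr y∈ vy) (nbr z∈ vz)
    where
    k : ℕ
    k = length c
    Next Prev : Fin n → Set
    Next x = ∃ λ j → lookup c j ≡ x × CycNext G k (toℕ i) (toℕ j)
    Prev x = ∃ λ j → lookup c j ≡ x × CycNext G k (toℕ j) (toℕ i)
    nbr : ∀ {x} → x ∈ₛ _ → Adj G (lookup c i) x → Next x ⊎ Prev x
    nbr {x} x∈ a with Any.index (to (∈c _) x∈) | Anyₚ.lookup-index (to (∈c _) x∈)
    ... | j | refl = Sum.map (λ h → j , refl , h) (λ h → j , refl , h) (to (adj⇔ i j) a)
    next-unique : ∀ {x y} → Next x → Next y → x ≡ y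
    next-unique (j , refl , p) (j′ , refl , q) = cong (lookup c) (Finₚ.toℕ-injective (same p q))
      where
      same : CycNext G k (toℕ i) (toℕ j) → CycNext G k (toℕ i) (toℕ j′) → toℕ j ≡ toℕ j′
      same (inj₁ p) (inj₁ q) = ≡-trans p (≡-sym q)
      same (inj₁ p) (inj₂ (e , _)) = contradiction (≡-trans p e) (<⇒≢ (Finₚ.toℕ<n j))
      same (inj₂ (e , _)) (inj₁ q) = contradiction (≡-trans q e) (<⇒≢ (Finₚ.toℕ<n j′))
      same (inj₂ (_ , p)) (inj₂ (_ , q)) = ≡-trans p (≡-sym q)
    prev-unique : ∀ {x y} → Prev x → Prev y → x ≡ y
    prev-unique (j , refl , p) (j′ , refl , q) = cong (lookup c) (Finₚ.toℕ-injective (same p q))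
      where
      same : CycNext G k (toℕ j) (toℕ i) → CycNext G k (toℕ j′) (toℕ i) → toℕ j ≡ toℕ j′
      same (inj₁ p) (inj₁ q) = suc-injective (≡-trans (≡-sym p) q)
      same (inj₁ p) (inj₂ (_ , e)) = contradiction (≡-trans (≡-sym p) e) λ ()
      same (inj₂ (_ , e)) (inj₁ q) = contradiction (≡-trans (≡-sym q) e) λ ()
      same (inj₂ (p , _)) (inj₂ (q , _)) = suc-injective (≡-trans p (≡-sym q))

  -- Induction on the size of the complement: a non-separable set is a block unless a larger one exists.
  nonseparable-degree : BlockCycle G → ∀ k {S : Subset n} → n ≤ k + ∣ S ∣ → NonSeparable G S →
    ∀ {v x y z} → v ∈ₛ S → x ∈ₛ S → y ∈ₛ S → z ∈ₛ S → x ≢ y → y ≢ z → x ≢ z →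
    Adj G v x → Adj G v y → Adj G v z → ⊥
  nonseparable-degree bc k {S} n≤ ns v∈ x∈ y∈ z∈ x≢y y≢z x≢z vx vy vz
    with bc S (ns , maximal k n≤)
    where
    -- A strictly larger non-separable set would contain the same vertex with the same three
    -- neighbours, which the induction hypothesis refutes. So `S` itself is a block, and no block
    -- around it has to be constructed.
    larger : ∀ k → n ≤ k + ∣ S ∣ → ∀ {T} → S ⊆ T → NonSeparable G T → ∀ {w} → w ∈ₛ T → w ∉ₛ S → ⊥
    larger zero n≤ {T} S⊆T _ w∈ w∉ =
      <-irrefl refl (<-≤-trans (≤-<-trans n≤ (p⊂q⇒∣p∣<∣q∣ (S⊆T , _ , w∈ , w∉))) (∣p∣≤n T))
    larger (suc k) n≤ {T} S⊆T nsT w∈ w∉ = nonseparable-degree bc k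
      (≤-trans n≤ (≤-trans (≤-reflexive (≡-sym (+-suc k ∣ S ∣)))
        (+-monoʳ-≤ k (p⊂q⇒∣p∣<∣q∣ (S⊆T , _ , w∈ , w∉)))))
      nsT (S⊆T v∈) (S⊆T x∈) (S⊆T y∈) (S⊆T z∈) x≢y y≢z x≢z vx vy vz
    maximal : ∀ k → n ≤ k + ∣ S ∣ → ∀ T → S ⊆ T → NonSeparable G T → T ⊆ S
    maximal k n≤ T S⊆T nsT {w} w∈ with w Subsetₚ.∈? S
    ... | yes w∈S = w∈S
    ... | no w∉S = ⊥-elim (larger k n≤ S⊆T nsT w∈ w∉S)
  ... | inj₁ edge = edge-no-three edge x∈ y∈ z∈ x≢y y≢z x≢z
  ... | inj₂ cycle = cycle-degree cycle v∈ x∈ y∈ z∈ x≢y y≢z x≢z vx vy vz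

  -- One non-separable set contains `v`, `x`, `y` and another contains `v`, `y`, `z`. They share the
  -- two vertices `v` and `y`, so their union is non-separable and gives `v` too large a degree.
  no-three-branches : BlockCycle G → ∀ {v x y z} → x ≢ y → y ≢ z → x ≢ z →
    Adj G v x → Adj G v y → Adj G v z →
    WalkIn G (⊤ - v) x y → WalkIn G (⊤ - v) y z → ⊥
  no-three-branches bc x≢y y≢z x≢z vx vy vz ω₁ ω₂
    with cycle-nonseparable vx vy ω₁ | cycle-nonseparable vy vz ω₂
  ... | S , nsS , v∈S , x∈S , y∈S | T , nsT , v∈T , y∈T , z∈T =
    nonseparable-degree bc n (m≤m+n n _)
      (nonseparable-∪ nsS nsT (adj-≢ vy) v∈S y∈S v∈T y∈T)
      (p⊆p∪q T v∈S) (p⊆p∪q T x∈S) (p⊆p∪q T y∈S) (q⊆p∪q S T z∈T)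
      x≢y y≢z x≢z vx vy vz

-- Edges between a path and the paths already covered

module _ {n : ℕ} (G : Graph n) where

  -- A predicate in place of a `Subset` allows as regions the members of a list, all vertices other
  -- than a given one, and the whole graph.
  data Walk (P : Fin n → Set) : Fin n → Fin n → Set where
    stop : ∀ {x} → P x → Walk P x x
    _∷⟨_⟩_ : ∀ {x y z} → P x → Adj G x y → Walk P y z → Walk P x z

  walk-map : ∀ {P Q : Fin n → Set} {x y} → (∀ {z} → P z → Q z) → Walk P x y → Walk Q x y
  walk-map f (stop p) = stop (f p)
  walk-map f (p ∷⟨ a ⟩ w) = f p ∷⟨ a ⟩ walk-map f w

  walk-start : ∀ {P : Fin n → Set} {x y} → Walk P x y → P x
  walk-start (stop p) = p
  walk-start (p ∷⟨ _ ⟩ _) = p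

  walk-trans : ∀ {P : Fin n → Set} {x y z} → Walk P x y → Walk P y z → Walk P x z
  walk-trans (stop _) w = w
  walk-trans (p ∷⟨ a ⟩ w) w′ = p ∷⟨ a ⟩ walk-trans w w′

  walk-sym : ∀ {P : Fin n → Set} {x y} → Walk P x y → Walk P y x
  walk-sym (stop p) = stop p
  walk-sym (p ∷⟨ a ⟩ w) = walk-trans (walk-sym w) (walk-start w ∷⟨ adj-sym G a ⟩ stop p)

  walk-walkIn : ∀ {P : Fin n → Set} {S x y} → (∀ {z} → P z → z ∈ₛ S) → Walk P x y → WalkIn G S x y
  walk-walkIn f (stop p) = here (f p)
  walk-walkIn f (p ∷⟨ a ⟩ w) = step (f p) a (walk-walkIn f w)

  Everywhere : Fin n → Set
  Everywhere _ = Unit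

  everywhere : ∀ {P : Fin n → Set} {x y} → Walk P x y → Walk Everywhere x y
  everywhere = walk-map λ _ → tt

  ComponentwiseConnected : (Fin n → Set) → Set
  ComponentwiseConnected U = ∀ {x y} → U x → U y → Walk Everywhere x y → Walk U x y

  -- Adjacency is phrased with `Step` instead of indices, so that reversing a path or passing to its
  -- tail involves no arithmetic.
  record InducedPath (p : List (Fin n)) : Set where
    field
      unique : Unique p
      edge   : ∀ {x y} → Step x y p → Adj G x y
      chord  : ∀ {x y} → x ∈ p → y ∈ p → Adj G x y → Step x y p ⊎ Step y x p

  open InducedPath

  isInducedPath⇒inducedPath : ∀ {p} → IsInducedPath G p → InducedPath p
  isInducedPath⇒inducedPath {p} (_ , u , adj⇔) = record { unique = u ; edge = e ; chord = c }
    where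
    e : ∀ {x y} → Step x y p → Adj G x y
    e s with step-lookup⁺ s
    ... | i , j , refl , refl , h = from (adj⇔ i j) (inj₁ h)
    c : ∀ {x y} → x ∈ p → y ∈ p → Adj G x y → Step x y p ⊎ Step y x p
    c x∈ y∈ a with Any.index x∈ | Any.index y∈ | Anyₚ.lookup-index x∈ | Anyₚ.lookup-index y∈
    ... | i | j | refl | refl = Sum.map (step-lookup⁻ p i j) (step-lookup⁻ p j i) (to (adj⇔ i j) a)

  inducedPath-reverse : ∀ {p} → InducedPath p → InducedPath (reverse p)
  inducedPath-reverse {p} ip = record
    { unique = unique-↭ (↭-sym (↭-reverse p)) (unique ip)
    ; edge = λ s → adj-sym G (edge ip (unreverse s))
    ; chord = λ x∈ y∈ a → Sum.swap (Sum.map step-reverse step-reverse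
        (chord ip (∈-resp-↭ (↭-reverse p) x∈) (∈-resp-↭ (↭-reverse p) y∈) a))
    }
    where
    unreverse : ∀ {x y} → Step x y (reverse p) → Step y x p
    unreverse s = subst (Step _ _) (reverse-involutive p) (step-reverse s)

  walk-to-head : ∀ {p z zs} → (∀ {x y} → Step x y (z ∷ zs) → Adj G x y) → (∀ {y} → y ∈ z ∷ zs → y ∈ p) →
                 ∀ {x} → x ∈ z ∷ zs → Walk (_∈ p) x z
  walk-to-head e ⊆p (here refl) = stop (⊆p (here refl))
  walk-to-head {zs = z′ ∷ zs} e ⊆p (there x∈) = walk-trans
    (walk-to-head (e ∘ there) (⊆p ∘ there) x∈)
    (⊆p (there (here refl)) ∷⟨ adj-sym G (e here) ⟩ stop (⊆p (here refl)))

  inducedPath-connected : ∀ {p} → InducedPath p → ∀ {x y} → x ∈ p → y ∈ p → Walk (_∈ p) x y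
  inducedPath-connected {z ∷ zs} ip x∈ y∈ = walk-trans (w x∈) (walk-sym (w y∈))
    where
    w : ∀ {x} → x ∈ z ∷ zs → Walk (_∈ z ∷ zs) x z
    w = walk-to-head (edge ip) id

  last-step : ∀ {z zs} → Unique (z ∷ zs) → (∀ {x y} → Step x y (z ∷ zs) → Adj G x y) →
    ∀ {x} → x ∈ zs → ∃ λ α → Step α x (z ∷ zs) × Walk (_≢ x) α z
  last-step u e (here refl) = _ , here , stop λ { refl → ∉-head u (here refl) }
  last-step u@(_ ∷ u′) e (there x∈) with last-step u′ (e ∘ there) x∈
  ... | α , s , w = α , there s , walk-trans w
    ((λ { refl → ∉-head u′ x∈ }) ∷⟨ adj-sym G (e here) ⟩ stop λ { refl → ∉-head u (there x∈) })

  -- The stretch of the path between `x` and `y` misses `x` once its first edge is taken. It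
  -- provides the branch at `x` towards an edge to U that leaves the path earlier.
  neighbour-before : ∀ {p} → Unique p → (∀ {x y} → Step x y p → Adj G x y) →
    ∀ {x y} → x ∈ p → y ∈ p → position y p < position x p →
    ∃ λ α → Step α x p × Walk (_≢ x) α y
  neighbour-before {z ∷ zs} u e {x} {y} x∈ y∈ lt with x Finₚ.≟ z | y Finₚ.≟ z | x∈ | y∈
  ... | no x≢z | _ | here q | _ = contradiction q x≢z
  ... | no _ | yes refl | there x∈′ | _ = last-step u e x∈′
  ... | no _ | no y≢z | there _ | here q = contradiction q y≢z
  neighbour-before {z ∷ zs} (_ ∷ u) e {x} {y} x∈ y∈ (s≤s lt) | no _ | no _ | there x∈′ | there y∈′
    with neighbour-before u (e ∘ there) x∈′ y∈′ lt
  ... | α , s , w = α , there s , w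

  neighbour-after : ∀ {p} → Unique p → (∀ {x y} → Step x y p → Adj G x y) →
    ∀ {x y} → x ∈ p → y ∈ p → position x p < position y p →
    ∃ λ α → Step x α p × Walk (_≢ x) α y
  neighbour-after {z ∷ zs} u e {x} {y} x∈ y∈ lt with x Finₚ.≟ z | y Finₚ.≟ z | x∈ | y∈
  ... | no x≢z | _ | here q | _ = contradiction q x≢z
  ... | _ | no y≢z | _ | here q = contradiction q y≢z
  neighbour-after {z ∷ z′ ∷ zs} u e x∈ y∈ lt | yes refl | no _ | _ | there y∈′ =
    z′ , here , walk-map (λ { h refl → ∉-head u h }) (walk-sym (walk-to-head (e ∘ there) id y∈′))
  neighbour-after {z ∷ zs} (_ ∷ u) e {x} {y} x∈ y∈ (s≤s lt) | no _ | no _ | there x∈′ | there y∈′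
    with neighbour-after u (e ∘ there) x∈′ y∈′ lt
  ... | α , s , w = α , there s , w

  module Attachments (bc : BlockCycle G) {U : Fin n → Set} (U-conn : ComponentwiseConnected U)
    {p : List (Fin n)} (ip : InducedPath p) (disjoint : ∀ {x} → x ∈ p → ¬ U x) where

    Attached : Fin n × Fin n → Set
    Attached (x , u) = x ∈ p × U u × Adj G x u

    record Branch (x α : Fin n) : Set where
      field
        adjacent : Adj G x α
        {root}   : Fin n
        root∈U   : U root
        walk     : Walk (_≢ x) α root

    open Branch

    -- The two roots lie in one component of the graph, if only by way of `x`. Hence U joins them
    -- internally, and this connection misses `x`, which lies on `p`.
    branches-joined : ∀ {x α β} → x ∈ p → Branch x α → Branch x β → WalkIn G (⊤ - x) α β
    branches-joined {x} x∈ a b = walk-walkIn (λ z≢x → x∈p∧x≢y⇒x∈p-y ∈⊤ z≢x)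
      (walk-trans (walk a) (walk-trans (walk-map (λ { h refl → disjoint x∈ h }) between) (walk-sym (walk b))))
      where
      between : Walk U (root a) (root b)
      between = U-conn (root∈U a) (root∈U b)
        (walk-trans (walk-sym (everywhere (walk a)))
          (tt ∷⟨ adj-sym G (adjacent a) ⟩ (tt ∷⟨ adjacent b ⟩ everywhere (walk b))))

    own-branch : ∀ {x u} → Attached (x , u) → Branch x u
    own-branch {x} {u} (x∈ , u∈ , a) = record
      { adjacent = a ; root∈U = u∈ ; walk = stop λ { refl → disjoint x∈ u∈ } }

    extend : ∀ {x y u α} → x ∈ p → x ≢ y → Adj G x α → Walk (_≢ x) α y → Attached (y , u) → Branch x α
    extend x∈ x≢y adj w (_ , u∈ , a) = record
      { adjacent = adj ; root∈U = u∈
      ; walk = walk-trans w ((≢-sym x≢y) ∷⟨ a ⟩ stop λ { refl → disjoint x∈ u∈ }) }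

    -- The final disjunction records whether `α` was found in U or on `p`; the three branches are
    -- told apart by it.
    branch-before : ∀ {x y u} → x ∈ p → Attached (y , u) → position y p ≤ position x p →
      ∃ λ α → Branch x α × ((x ≡ y × α ≡ u) ⊎ Step α x p)
    branch-before {x} {y} x∈ at@(y∈ , _) le with x Finₚ.≟ y
    ... | yes refl = _ , own-branch at , inj₁ (refl , refl)
    ... | no x≢y with neighbour-before (unique ip) (edge ip) x∈ y∈
                        (≤∧≢⇒< le (x≢y ∘ ≡-sym ∘ position-injective y∈))
    ...   | α , s , w = α , extend x∈ x≢y (adj-sym G (edge ip s)) w at , inj₂ s

    branch-after : ∀ {x y u} → x ∈ p → Attached (y , u) → position x p ≤ position y p →
      ∃ λ α → Branch x α × ((x ≡ y × α ≡ u) ⊎ Step x α p)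
    branch-after {x} {y} x∈ at@(y∈ , _) le with x Finₚ.≟ y
    ... | yes refl = _ , own-branch at , inj₁ (refl , refl)
    ... | no x≢y with neighbour-after (unique ip) (edge ip) x∈ y∈
                        (≤∧≢⇒< le (x≢y ∘ position-injective x∈))
    ...   | α , s , w = α , extend x∈ x≢y (edge ip s) w at , inj₂ s

    -- The middle vertex `y` has three branches: its own edge to U, one towards `x` and one towards
    -- `z`. Their first vertices differ: a vertex of U is not on `p`, two in U belong to different
    -- edges at `y`, and two on `p` are the predecessor and the successor of `y`.
    no-three-sorted : ∀ {x y z u v w} → Attached (x , u) → Attached (y , v) → Attached (z , w) →
      position x p ≤ position y p → position y p ≤ position z p →
      (x , u) ≢ (y , v) → (y , v) ≢ (z , w) → (x , u) ≢ (z , w) → ⊥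
    no-three-sorted a b@(y∈ , v∈ , _) c x≤y y≤z ≢₁ ≢₂ ≢₃
      with branch-before y∈ a x≤y | branch-after y∈ c y≤z
    ... | α , A , posA | γ , C , posC =
      no-three-branches G bc (α≢v posA) (v≢γ posC) (α≢γ posA posC)
        (adjacent A) (adjacent B) (adjacent C) (branches-joined y∈ A B) (branches-joined y∈ B C)
      where
      B = own-branch b
      α≢v : _ ⊎ _ → α ≢ _
      α≢v (inj₁ (refl , refl)) refl = ≢₁ refl
      α≢v (inj₂ s) refl = disjoint (step-∈ˡ s) v∈
      v≢γ : _ ⊎ _ → _ ≢ γ
      v≢γ (inj₁ (refl , refl)) refl = ≢₂ refl
      v≢γ (inj₂ s) refl = disjoint (step-∈ʳ s) v∈
      α≢γ : _ ⊎ _ → _ ⊎ _ → α ≢ γ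
      α≢γ (inj₁ (refl , refl)) (inj₁ (refl , refl)) refl = ≢₃ refl
      α≢γ (inj₁ (refl , refl)) (inj₂ s) refl = disjoint (step-∈ʳ s) (proj₁ (proj₂ a))
      α≢γ (inj₂ s) (inj₁ (refl , refl)) refl = disjoint (step-∈ˡ s) (proj₁ (proj₂ c))
      α≢γ (inj₂ s) (inj₂ t) refl = step-asym (unique ip) s t

    no-three-attachments : ∀ {e f g} → Attached e → Attached f → Attached g →
      e ≢ f → f ≢ g → e ≢ g → ⊥
    no-three-attachments {x , _} {y , _} {z , _} a b c ≢₁ ≢₂ ≢₃
      with ≤-total (position x p) (position y p) | ≤-total (position y p) (position z p)
         | ≤-total (position x p) (position z p)
    ... | inj₁ xy | inj₁ yz | _ = no-three-sorted a b c xy yz ≢₁ ≢₂ ≢₃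
    ... | inj₁ xy | inj₂ zy | inj₁ xz = no-three-sorted a c b xz zy ≢₃ (≢-sym ≢₂) ≢₁
    ... | inj₁ xy | inj₂ zy | inj₂ zx = no-three-sorted c a b zx xy (≢-sym ≢₃) ≢₁ (≢-sym ≢₂)
    ... | inj₂ yx | inj₁ yz | inj₁ xz = no-three-sorted b a c yx xz (≢-sym ≢₁) ≢₃ ≢₂
    ... | inj₂ yx | inj₁ yz | inj₂ zx = no-three-sorted b c a yz zx ≢₂ (≢-sym ≢₃) (≢-sym ≢₁)
    ... | inj₂ yx | inj₂ zy | _ = no-three-sorted c b a zy yx (≢-sym ≢₂) (≢-sym ≢₁) (≢-sym ≢₃)

-- Forcing schedules

module _ {n : ℕ} (G : Graph n) where

  open InducedPath

  -- Along each path the predecessor x of y may force y once x and all other neighbours of x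
  -- in the paths are black; a rank is a time schedule obeying these dependencies.
  IsRank : List (List (Fin n)) → (Fin n → ℕ) → Set
  IsRank qs τ = ∀ {x y} → Any (Step x y) qs →
    τ x < τ y × (∀ w → w ∈ concat qs → Adj G x w → w ≢ y → τ w < τ y)

  -- The new path q is run up to position c, then the old schedule up to time T, then the
  -- rest of q, then the rest of the old schedule.
  module Splice (q : List (Fin n)) (τ : Fin n → ℕ) (c T : ℕ) where

    -- `N` exceeds every position in `q`, even the default for absent vertices. The four stages
    -- therefore occupy consecutive ranges: below `N`, then from `N` to `N + T`, then from
    -- `N + suc T`, and finally from `N + (suc T + N)`.
    N : ℕ
    N = suc (length q)

    onPath offPath spliced : Fin n → ℕ
    onPath v with position v q <? c
    ... | yes _ = position v q
    ... | no _ = N + (suc T + position v q)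
    offPath v with τ v ≤? T
    ... | yes _ = N + τ v
    ... | no _ = N + (τ v + N)
    spliced v with v ∈? q
    ... | yes _ = onPath v
    ... | no _ = offPath v

    position<N : ∀ v → position v q < N
    position<N v = s≤s (position≤length v q)

    step-< : Unique q → ∀ {x y} → Step x y q → spliced x < spliced y
    step-< u {x} {y} s with x ∈? q | y ∈? q
    ... | no x∉ | _ = contradiction (step-∈ˡ s) x∉
    ... | yes _ | no y∉ = contradiction (step-∈ʳ s) y∉
    ... | yes _ | yes _ with position x q <? c | position y q <? c
    ...   | yes _ | yes _ = ≤-reflexive (≡-sym (position-step u s))
    ...   | yes _ | no _ = <-≤-trans (position<N x) (m≤m+n N _)
    ...   | no ¬x | yes y< = contradiction (<-trans (≤-reflexive (≡-sym (position-step u s))) y<) ¬x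
    ...   | no _ | no _ = +-monoʳ-< N (+-monoʳ-< (suc T) (≤-reflexive (≡-sym (position-step u s))))

    off-off : ∀ {u v} → u ∉ q → v ∉ q → τ u < τ v → spliced u < spliced v
    off-off {u} {v} u∉ v∉ lt with u ∈? q | v ∈? q
    ... | yes u∈ | _ = contradiction u∈ u∉
    ... | no _ | yes v∈ = contradiction v∈ v∉
    ... | no _ | no _ with τ u ≤? T | τ v ≤? T
    ...   | yes _ | yes _ = +-monoʳ-< N lt
    ...   | yes _ | no _ = +-monoʳ-< N (<-≤-trans lt (m≤m+n (τ v) N))
    ...   | no ¬u | yes v≤ = contradiction (<⇒≤ (<-≤-trans lt v≤)) ¬u
    ...   | no _ | no _ = +-monoʳ-< N (+-monoˡ-< N lt)

    off-on : ∀ {u y} → u ∉ q → y ∈ q → τ u ≤ T → c ≤ position y q → spliced u < spliced y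
    off-on {u} {y} u∉ y∈ u≤T c≤ with u ∈? q | y ∈? q
    ... | yes u∈ | _ = contradiction u∈ u∉
    ... | no _ | no y∉ = contradiction y∈ y∉
    ... | no _ | yes _ with τ u ≤? T | position y q <? c
    ...   | no ¬u | _ = contradiction u≤T ¬u
    ...   | yes _ | yes y< = contradiction c≤ (<⇒≱ y<)
    ...   | yes _ | no _ = +-monoʳ-< N (≤-trans (s≤s u≤T) (m≤m+n (suc T) _))

    on-off : ∀ {x v} → x ∈ q → v ∉ q → (c ≤ position x q → T < τ v) → spliced x < spliced v
    on-off {x} {v} x∈ v∉ h with x ∈? q | v ∈? q
    ... | no x∉ | _ = contradiction x∈ x∉
    ... | yes _ | yes v∈ = contradiction v∈ v∉
    ... | yes _ | no _ with position x q <? c | τ v ≤? T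
    ...   | yes _ | yes _ = <-≤-trans (position<N x) (m≤m+n N _)
    ...   | yes _ | no _ = <-≤-trans (position<N x) (m≤m+n N _)
    ...   | no ¬x | yes v≤ = contradiction v≤ (<⇒≱ (h (≮⇒≥ ¬x)))
    ...   | no ¬x | no _ = +-monoʳ-< N (≤-trans (+-monoʳ-< (suc T) (position<N x)) (+-monoˡ-≤ N (h (≮⇒≥ ¬x))))

  -- The two long hypotheses are the waits across an edge xu between `q` and the old paths. A force
  -- by `u` waits for `x`, so if `x` comes late the force must come after `T`. A force by `x` waits
  -- for `u`, so `u` must be early and the successor of `x` late. Waits within `q` or within the old
  -- paths survive because splicing keeps both orders.
  splice-rank : ∀ {q qs τ} → InducedPath G q → (∀ {x} → x ∈ q → x ∉ concat qs) → IsRank qs τ → ∀ c T →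
    (∀ {x u v} → x ∈ q → u ∈ concat qs → Adj G x u → Any (Step u v) qs → c ≤ position x q → T < τ v) →
    (∀ {x u} → x ∈ q → u ∈ concat qs → Adj G x u → c ≤ suc (position x q) × τ u ≤ T) →
    ∃ (IsRank (q ∷ qs))
  splice-rank {q} {qs} {τ} ip disjoint rank c T late attached = spliced , isRank
    where
    open Splice q τ c T
    off : ∀ {x} → x ∈ concat qs → x ∉ q
    off x∈ x∈q = disjoint x∈q x∈
    isRank : IsRank (q ∷ qs) spliced
    isRank (here s) = step-< (unique ip) s , nbr
      where
      nbr : ∀ w → w ∈ concat (q ∷ qs) → Adj G _ w → w ≢ _ → spliced w < spliced _
      nbr w w∈ a w≢y with ∈-++⁻ q w∈
      ... | inj₂ w∈U with attached (step-∈ˡ s) w∈U a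
      ...   | c≤ , τ≤ = off-on (off w∈U) (step-∈ʳ s) τ≤
                (≤-trans c≤ (≤-reflexive (≡-sym (position-step (unique ip) s))))
      -- As `q` is induced, the only neighbour of `x` on it besides `y` is the predecessor of `x`.
      nbr w w∈ a w≢y | inj₁ w∈q with chord ip (step-∈ˡ s) w∈q a
      ... | inj₁ t = contradiction (step-functional (unique ip) t s) w≢y
      ... | inj₂ t = <-trans (step-< (unique ip) t) (step-< (unique ip) s)
    isRank {x} {y} (there ss) = off-off (off x∈) (off y∈) (proj₁ (rank ss)) , nbr
      where
      x∈ : x ∈ concat qs
      x∈ = ∈-concat⁺ (Any.map step-∈ˡ ss)
      y∈ : y ∈ concat qs
      y∈ = ∈-concat⁺ (Any.map step-∈ʳ ss)
      nbr : ∀ w → w ∈ concat (q ∷ qs) → Adj G x w → w ≢ y → spliced w < spliced y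
      nbr w w∈ a w≢y with ∈-++⁻ q w∈
      ... | inj₁ w∈q = on-off w∈q (off y∈) (late w∈q x∈ (adj-sym G a) ss)
      ... | inj₂ w∈U = off-off (off w∈U) (off y∈) (proj₂ (rank ss) w w∈U a w≢y)

  -- No vertex before `a` has an old neighbour, so `q` runs freely up to and including `a`, whence
  -- the `suc` in the threshold. A force by `u` then finds `a` black. A force by `v` comes after
  -- time `τ v`, hence after the rest of `q` and in particular after `b`. That rest waits only for
  -- `u` and `v`, both black by `τ v`.
  splice-attachments : ∀ {q qs τ} → InducedPath G q → (∀ {x} → x ∈ q → x ∉ concat qs) → IsRank qs τ →
    ∀ {a u b v} → position a q ≤ position b q → τ u ≤ τ v →
    (∀ {x w} → x ∈ q → w ∈ concat qs → Adj G x w → (x ≡ a × w ≡ u) ⊎ (x ≡ b × w ≡ v)) →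
    ∃ (IsRank (q ∷ qs))
  splice-attachments {q} {qs} {τ} ip disjoint rank {a} {u} {b} {v} a≤b u≤v only =
    splice-rank ip disjoint rank (suc (position a q)) (τ v) late attached
    where
    late : ∀ {x w y} → x ∈ q → w ∈ concat qs → Adj G x w → Any (Step w y) qs →
           suc (position a q) ≤ position x q → τ v < τ y
    late x∈ w∈ adj s lt with only x∈ w∈ adj
    ... | inj₁ (refl , refl) = contradiction lt (<-irrefl refl)
    ... | inj₂ (refl , refl) = proj₁ (rank s)
    attached : ∀ {x w} → x ∈ q → w ∈ concat qs → Adj G x w →
               suc (position a q) ≤ suc (position x q) × τ w ≤ τ v
    attached x∈ w∈ adj with only x∈ w∈ adj
    ... | inj₁ (refl , refl) = ≤-refl , u≤v
    ... | inj₂ (refl , refl) = s≤s a≤b , ≤-refl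

  -- Orienting and adding one path

  Oriented : List (Fin n) → List (Fin n) → Set
  Oriented p q = q ≡ p ⊎ q ≡ reverse p

  oriented-↭ : ∀ {p q} → Oriented p q → q ↭ p
  oriented-↭ (inj₁ refl) = refl
  oriented-↭ {p} (inj₂ refl) = ↭-reverse p

  oriented-inducedPath : ∀ {p q} → InducedPath G p → Oriented p q → InducedPath G q
  oriented-inducedPath ip (inj₁ refl) = ip
  oriented-inducedPath ip (inj₂ refl) = inducedPath-reverse G ip

  orient-towards : ∀ {p} → InducedPath G p → ∀ {a b} → a ∈ p → b ∈ p →
    ∃ λ q → Oriented p q × position a q ≤ position b q
  orient-towards {p} ip a∈ b∈ with position-reverse (unique ip) a∈ b∈
  ... | inj₁ le = p , inj₁ refl , le
  ... | inj₂ le = reverse p , inj₂ refl , le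

  module _ (bc : BlockCycle G) {qs : List (List (Fin n))}
           (conn : ComponentwiseConnected G (_∈ concat qs))
           {p : List (Fin n)} (ip : InducedPath G p) (disjoint : ∀ {x} → x ∈ p → x ∉ concat qs)
           {τ : Fin n → ℕ} (rank : IsRank qs τ) where

    open Attachments G bc conn ip disjoint

    Result : Set
    Result = ∃ λ q → Oriented p q × ∃ (IsRank (q ∷ qs))

    add-path-≤ : ∀ {a u b v} → Attached (a , u) → Attached (b , v) → τ u ≤ τ v →
      (∀ {e} → Attached e → e ≡ (a , u) ⊎ e ≡ (b , v)) → Result
    add-path-≤ (a∈ , _) (b∈ , _) u≤v only with orient-towards ip a∈ b∈
    ... | q , o , a≤b = q , o ,
      splice-attachments (oriented-inducedPath ip o) (disjoint ∘ ∈-resp-↭ (oriented-↭ o)) rank a≤b u≤v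
        λ x∈ w∈ adj → Sum.map (λ { refl → refl , refl }) (λ { refl → refl , refl })
          (only (∈-resp-↭ (oriented-↭ o) x∈ , w∈ , adj))

    add-path-two : ∀ {e f} → Attached e → Attached f →
      (∀ {g} → Attached g → g ≡ e ⊎ g ≡ f) → Result
    add-path-two {_ , u} {_ , v} e f only with ≤-total (τ u) (τ v)
    ... | inj₁ le = add-path-≤ e f le only
    ... | inj₂ le = add-path-≤ f e le (Sum.swap ∘ only)

    attached? : ∀ e → Dec (Attached e)
    attached? (x , u) = (x ∈? p) ×-dec (u ∈? concat qs) ×-dec (adj G x u Boolₚ.≟ true)

    attachment? : ∀ {P : Fin n × Fin n → Set} → (∀ e → Dec (P e)) → Dec (∃ λ e → Attached e × P e)
    attachment? P? with Finₚ.any? (λ x → Finₚ.any? (λ u → attached? (x , u) ×-dec P? (x , u)))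
    ... | yes (x , u , h) = yes ((x , u) , h)
    ... | no ¬h = no λ ((x , u) , h) → ¬h (x , u , h)

    add-path : Result
    add-path with attachment? {λ _ → Unit} (λ _ → yes tt)
    -- No edge joins `p` to the old paths, so the thresholds are arbitrary.
    ... | no none = p , inj₁ refl , splice-rank ip disjoint rank 0 0
      (λ x∈ w∈ a _ _ → contradiction ((_ , _) , (x∈ , w∈ , a) , tt) none)
      (λ x∈ w∈ a → contradiction ((_ , _) , (x∈ , w∈ , a) , tt) none)
    ... | yes (e , at-e , _) with attachment? (λ f → ¬? (Productₚ.≡-dec Finₚ._≟_ Finₚ._≟_ f e))
    -- A single edge serves as both au and bv.
    ...   | no none = add-path-two at-e at-e λ {g} at-g → inj₁ (only g at-g)
      where
      only : ∀ g → Attached g → g ≡ e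
      only g at-g with Productₚ.≡-dec Finₚ._≟_ Finₚ._≟_ g e
      ... | yes g≡e = g≡e
      ... | no g≢e = contradiction (g , at-g , g≢e) none
    ...   | yes (f , at-f , f≢e) = add-path-two at-e at-f λ {g} at-g → only g at-g
      where
      only : ∀ g → Attached g → g ≡ e ⊎ g ≡ f
      only g at-g with Productₚ.≡-dec Finₚ._≟_ Finₚ._≟_ g e | Productₚ.≡-dec Finₚ._≟_ Finₚ._≟_ g f
      ... | yes g≡e | _ = inj₁ g≡e
      ... | no _ | yes g≡f = inj₂ g≡f
      ... | no g≢e | no g≢f =
        ⊥-elim (no-three-attachments at-e at-f at-g (≢-sym f≢e) (≢-sym g≢f) (≢-sym g≢e))

  -- The path added last stands at the head. Each connectedness condition concerns the tail, which
  -- is U at the moment when that path arrives.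
  data Ordered : List (List (Fin n)) → Set where
    []  : Ordered []
    _∷_ : ∀ {p ps} → ComponentwiseConnected G (_∈ concat ps) → Ordered ps → Ordered (p ∷ ps)

  orientation-concat : ∀ {ps qs} → Orientation G ps qs → concat qs ↭ concat ps
  orientation-concat [] = refl
  orientation-concat (o ∷ os) = ++⁺ (oriented-↭ o) (orientation-concat os)

  orient : BlockCycle G → ∀ {ps} → Ordered ps → All (InducedPath G) ps → Unique (concat ps) →
    ∃ λ qs → Orientation G ps qs × ∃ (IsRank qs)
  orient bc [] _ _ = [] , [] , (λ _ → 0) , λ ()
  orient bc {p ∷ ps} (conn ∷ ord) (ip ∷ ips) u with unique-++⁻ p u
  ... | _ , u′ , disj with orient bc ord ips u′
  ...   | qs , os , τ , rank with add-path bc {qs}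
              (λ x∈ y∈ w → walk-map G (∈-resp-↭ (↭-sym (orientation-concat os)))
                 (conn (∈-resp-↭ (orientation-concat os) x∈) (∈-resp-↭ (orientation-concat os) y∈) w))
              ip (λ x∈p → disj x∈p ∘ ∈-resp-↭ (orientation-concat os)) rank
  ...     | q , o , rank′ = q ∷ qs , o ∷ os , rank′

  -- Every vertex of `p` reaches `b` along `p` and the edge ab, so all walks can be anchored in the
  -- old set.
  connected-extend : ∀ {p ps} → InducedPath G p → ∀ {a b} → a ∈ p → b ∈ concat ps → Adj G a b →
    ComponentwiseConnected G (_∈ concat ps) → ComponentwiseConnected G (_∈ concat (p ∷ ps))
  connected-extend {p} {ps} ip {a} {b} a∈ b∈ adj conn x∈ y∈ w with anchor x∈ | anchor y∈
    where
    anchor : ∀ {x} → x ∈ concat (p ∷ ps) → ∃ λ r → r ∈ concat ps × Walk G (_∈ concat (p ∷ ps)) x r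
    anchor x∈ with ∈-++⁻ p x∈
    ... | inj₂ x∈U = _ , x∈U , stop x∈
    ... | inj₁ x∈p = b , b∈ , walk-trans G
      (walk-map G ∈-++⁺ˡ (inducedPath-connected G ip x∈p a∈))
      (∈-++⁺ˡ a∈ ∷⟨ adj ⟩ stop (∈-++⁺ʳ p b∈))
  ... | r , r∈ , wx | s , s∈ , wy =
    walk-trans G wx (walk-trans G
      (walk-map G (∈-++⁺ʳ p) (conn r∈ s∈
        (walk-trans G (walk-sym G (everywhere G wx)) (walk-trans G w (everywhere G wy)))))
      (walk-sym G wy))

  closed-walk : ∀ {U : Fin n → Set} → (∀ {x y} → U x → Adj G x y → U y) →
    ∀ {x y} → U x → Walk G (Everywhere G) x y → Walk G U x y
  closed-walk cl x∈ (stop _) = stop x∈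
  closed-walk cl x∈ (_ ∷⟨ a ⟩ w) = x∈ ∷⟨ a ⟩ closed-walk cl (cl x∈ a) w

  -- An old set closed under adjacency is a union of components of the graph. No walk leads from it
  -- to `p`, or else `p` lies inside it; either way only walks within one of the two have to be
  -- found.
  connected-new-component : ∀ {p ps} → InducedPath G p →
    (∀ {x y} → x ∈ concat ps → Adj G x y → y ∈ concat ps) →
    ComponentwiseConnected G (_∈ concat (p ∷ ps))
  connected-new-component {p} ip cl x∈ y∈ w with ∈-++⁻ p x∈ | ∈-++⁻ p y∈
  ... | inj₂ x∈U | _ = walk-map G (∈-++⁺ʳ p) (closed-walk cl x∈U w)
  ... | inj₁ _ | inj₂ y∈U = walk-map G (∈-++⁺ʳ p) (walk-sym G (closed-walk cl y∈U (walk-sym G w)))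
  ... | inj₁ x∈p | inj₁ y∈p = walk-map G ∈-++⁺ˡ (inducedPath-connected G ip x∈p y∈p)

  next-path : ∀ {p₀ todo₀ done} → let todo = p₀ ∷ todo₀ in
    ComponentwiseConnected G (_∈ concat done) → All (InducedPath G) todo →
    (∀ x → x ∈ concat done ⊎ x ∈ concat todo) →
    ∃₂ λ p rest → todo ↭ p ∷ rest × ComponentwiseConnected G (_∈ concat (p ∷ done))
  next-path {p₀} {todo₀} {done} conn ips cover
    with any? (λ p → any? (λ x → any? (λ u → adj G x u Boolₚ.≟ true) (concat done)) p) (p₀ ∷ todo₀)
  ... | yes found with find found
  ...   | p , p∈ , hit with find hit
  ...     | a , a∈ , hit′ with find hit′
  ...       | b , b∈ , a~b with ∈⇒↭∷ p∈
  ...         | rest , perm = p , rest , perm ,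
    connected-extend {ps = done} (All.lookup ips p∈) a∈ b∈ a~b conn
  next-path {p₀} {todo₀} {done} conn ips cover | no none =
    p₀ , todo₀ , refl , connected-new-component {ps = done} (All.head ips) closed
    where
    closed : ∀ {x y} → x ∈ concat done → Adj G x y → y ∈ concat done
    closed {x} {y} x∈ a with cover y
    ... | inj₁ y∈ = y∈
    ... | inj₂ y∈ = contradiction
      (Any.map (λ y∈p → lose y∈p (lose x∈ (adj-sym G a))) (∈-concat⁻ (p₀ ∷ todo₀) y∈)) none

  order-paths : ∀ k todo {done} → length todo ≤ k → Ordered done →
    ComponentwiseConnected G (_∈ concat done) → All (InducedPath G) todo →
    (∀ x → x ∈ concat done ⊎ x ∈ concat todo) →
    ∃ λ ps → Ordered ps × todo ++ done ↭ ps
  order-paths k [] len ord conn ips cover = _ , ord , refl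
  order-paths (suc k) todo@(_ ∷ _) {done} len ord conn ips cover
    with next-path {done = done} conn ips cover
  ... | p , rest , perm , conn′ with order-paths k rest {p ∷ done}
        (≤-pred (≤-trans (≤-reflexive (≡-sym (↭-length perm))) len))
        (conn ∷ ord) conn′ (All.tail (All-resp-↭ perm ips)) cover′
    where
    cover′ : ∀ x → x ∈ concat (p ∷ done) ⊎ x ∈ concat rest
    cover′ x with cover x
    ... | inj₁ x∈ = inj₁ (∈-++⁺ʳ p x∈)
    ... | inj₂ x∈ with ∈-++⁻ p (∈-resp-↭ (concat-↭ perm) x∈)
    ...   | inj₁ x∈p = inj₁ (∈-++⁺ˡ x∈p)
    ...   | inj₂ x∈rest = inj₂ x∈rest
  ...   | ps , ord′ , perm′ = ps , ord′ ,
    ↭-trans (++⁺ perm refl) (↭-trans (↭-sym (shift p rest done)) perm′)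

  oriented-rank : BlockCycle G → ∀ {ps} → IsPathCover G ps →
    ∃ λ qs → Orientation G ps qs × ∃ (IsRank qs)
  oriented-rank bc {ps} (induced , perm)
    with order-paths (length ps) ps ≤-refl [] (λ ()) ips (λ x → inj₂ (∈-resp-↭ (↭-sym perm) (∈-allFin x)))
    where
    ips : All (InducedPath G) ps
    ips = All.tabulate λ p∈ → isInducedPath⇒inducedPath G (induced _ p∈)
  ... | ps′ , ord , perm′ with subst (_↭ ps′) (++-identityʳ ps) perm′
  ...   | ps↭ with orient bc ord
              (All-resp-↭ ps↭ (All.tabulate λ p∈ → isInducedPath⇒inducedPath G (induced _ p∈)))
              (unique-↭ (concat-↭ ps↭) (unique-↭ (↭-sym perm) (Uniqueₚ.allFin⁺ _)))
  ...     | qs′ , os , τ , rank with pointwise-↭ ps↭ os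
  ...       | qs , os′ , qs↭ = qs , os′ , τ , λ s →
    let lt , nbr = rank (Any-resp-↭ qs↭ s) in
    lt , λ w w∈ → nbr w (∈-resp-↭ (concat-↭ qs↭) w∈)

-- Forcing along oriented paths

elements : ∀ {n} → Subset n → List (Fin n)
elements [] = []
elements (inside ∷ p) = zero ∷ map suc (elements p)
elements (outside ∷ p) = map suc (elements p)

length-elements : ∀ {n} (p : Subset n) → length (elements p) ≡ ∣ p ∣
length-elements [] = refl
length-elements (inside ∷ p) = cong suc (≡-trans (length-map suc (elements p)) (length-elements p))
length-elements (outside ∷ p) = ≡-trans (length-map suc (elements p)) (length-elements p)

elements⁺ : ∀ {n} {p : Subset n} {x} → x ∈ₛ p → x ∈ elements p
elements⁺ {p = inside ∷ p} here = here refl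
elements⁺ {p = inside ∷ p} (there x∈) = there (∈-map⁺ suc (elements⁺ x∈))
elements⁺ {p = outside ∷ p} (there x∈) = ∈-map⁺ suc (elements⁺ x∈)

elements⁻ : ∀ {n} (p : Subset n) {x} → x ∈ elements p → x ∈ₛ p
elements⁻ (inside ∷ p) (here refl) = here
elements⁻ (inside ∷ p) (there x∈) with ∈-map⁻ suc x∈
... | _ , y∈ , refl = there (elements⁻ p y∈)
elements⁻ (outside ∷ p) x∈ with ∈-map⁻ suc x∈
... | _ , y∈ , refl = there (elements⁻ p y∈)

elements-unique : ∀ {n} (p : Subset n) → Unique (elements p)
elements-unique [] = []
elements-unique (inside ∷ p) = unique-∷⁺
  (λ z∈ → case ∈-map⁻ suc z∈ of λ { (_ , _ , ()) })
  (Uniqueₚ.map⁺ Finₚ.suc-injective (elements-unique p))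
elements-unique (outside ∷ p) = Uniqueₚ.map⁺ Finₚ.suc-injective (elements-unique p)

∣∣-unique : ∀ {n} {p : Subset n} {xs} → Unique xs → (∀ {x} → x ∈ₛ p → x ∈ xs) →
  (∀ {x} → x ∈ xs → x ∈ₛ p) → ∣ p ∣ ≡ length xs
∣∣-unique {p = p} u f g = ≡-trans (≡-sym (length-elements p))
  (↭-length (unique-set⇒↭ (elements-unique p) u (f ∘ elements⁻ p) (elements⁺ ∘ g)))

fromList : ∀ {n} → List (Fin n) → Subset n
fromList [] = ∅
fromList (x ∷ xs) = fromList xs ∪ ⁅ x ⁆

fromList⁺ : ∀ {n} {x : Fin n} {xs} → x ∈ xs → x ∈ₛ fromList xs
fromList⁺ {x = x} {_ ∷ xs} (here refl) = q⊆p∪q (fromList xs) ⁅ x ⁆ (x∈⁅x⁆ x)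
fromList⁺ (there x∈) = p⊆p∪q _ (fromList⁺ x∈)

fromList⁻ : ∀ {n} {x : Fin n} xs → x ∈ₛ fromList xs → x ∈ xs
fromList⁻ [] x∈ = contradiction x∈ ∉⊥
fromList⁻ (y ∷ xs) x∈ = [ there ∘ fromList⁻ xs , here ]′ (∈-∪⁅⁆⁻ x∈)

module _ {A : Set} where

  heads : List (List A) → List A
  heads [] = []
  heads ([] ∷ qs) = heads qs
  heads ((x ∷ _) ∷ qs) = x ∷ heads qs

  heads⁺ : ∀ {x qs} → Any (λ q → head q ≡ just x) qs → x ∈ heads qs
  heads⁺ {qs = (_ ∷ _) ∷ qs} (here refl) = here refl
  heads⁺ {qs = [] ∷ qs} (there h) = heads⁺ h
  heads⁺ {qs = (_ ∷ _) ∷ qs} (there h) = there (heads⁺ h)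

  heads⁻ : ∀ {x} qs → x ∈ heads qs → Any (λ q → head q ≡ just x) qs
  heads⁻ ([] ∷ qs) x∈ = there (heads⁻ qs x∈)
  heads⁻ ((_ ∷ _) ∷ qs) (here refl) = here refl
  heads⁻ ((_ ∷ _) ∷ qs) (there x∈) = there (heads⁻ qs x∈)

  heads⊆concat : ∀ qs {x} → x ∈ heads qs → x ∈ concat qs
  heads⊆concat ([] ∷ qs) x∈ = heads⊆concat qs x∈
  heads⊆concat ((_ ∷ _) ∷ qs) (here refl) = here refl
  heads⊆concat ((_ ∷ q) ∷ qs) (there x∈) = there (∈-++⁺ʳ q (heads⊆concat qs x∈))

  heads-unique : ∀ qs → Unique (concat qs) → Unique (heads qs)
  heads-unique [] u = []
  heads-unique ([] ∷ qs) u = heads-unique qs u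
  heads-unique ((x ∷ q) ∷ qs) u = unique-∷⁺
    (λ x∈ → ∉-head u (∈-++⁺ʳ q (heads⊆concat qs x∈)))
    (heads-unique qs (proj₁ (proj₂ (unique-++⁻ (x ∷ q) u))))

  length-heads : ∀ {qs} → All (_≢ []) qs → length (heads qs) ≡ length qs
  length-heads [] = refl
  length-heads {[] ∷ qs} (ne ∷ nes) = contradiction refl ne
  length-heads {(_ ∷ _) ∷ qs} (ne ∷ nes) = cong suc (length-heads nes)

argmin : ∀ {n} {P : Fin n → Set} (P? : ∀ x → Dec (P x)) (τ : Fin n → ℕ) k {x} → τ x ≤ k → P x →
  ∃ λ y → P y × (∀ z → P z → τ y ≤ τ z)
argmin P? τ k {x} τx≤k px with Finₚ.any? (λ y → P? y ×-dec (τ y <? τ x))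
... | no none = x , px , λ z pz → ≮⇒≥ λ lt → none (z , pz , lt)
argmin P? τ zero τx≤k px | yes (y , py , lt) = contradiction (<-≤-trans lt τx≤k) λ ()
argmin P? τ (suc k) τx≤k px | yes (y , py , lt) = argmin P? τ k (≤-pred (<-≤-trans lt τx≤k)) py

module _ {n : ℕ} (G : Graph n) where

  afterForces⁻ : ∀ {B x} fs → x ∈ₛ afterForces G B fs → x ∈ₛ B ⊎ ∃ λ u → (u , x) ∈ fs
  afterForces⁻ [] x∈ = inj₁ x∈
  afterForces⁻ ((u , v) ∷ fs) x∈ with afterForces⁻ fs x∈
  ... | inj₂ (u′ , h) = inj₂ (u′ , there h)
  ... | inj₁ x∈′ with ∈-∪⁅⁆⁻ x∈′
  ...   | inj₁ x∈B = inj₁ x∈B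
  ...   | inj₂ refl = inj₂ (u , here refl)

  -- Take the white vertex of least rank. Its predecessor and all other neighbours of that
  -- predecessor have smaller rank, hence are black, so the force is legal. `k` bounds the number of
  -- white vertices.
  rank-forcing : ∀ {qs τ} → IsRank G qs τ → (∀ x → x ∈ concat qs) →
    (∀ {x y} → Any (Step x y) qs → Adj G x y) →
    ∀ {B} k → n ≤ k + ∣ B ∣ → (∀ x → x ∈ₛ B ⊎ ∃ λ u → Any (Step u x) qs) →
    ∃ λ fs → CompleteForcing G B fs × (∀ {u v} → (u , v) ∈ fs → Any (Step u v) qs)
  rank-forcing {qs} {τ} rank cover edges {B} k n≤ start
    with Finₚ.any? (λ x → ¬? (x Subsetₚ.∈? B))
  ... | no none = [] , (tt , λ x → decidable-stable (x Subsetₚ.∈? B) (λ x∉ → none (x , x∉))) , λ ()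
  ... | yes (x , x∉) with argmin (λ x → ¬? (x Subsetₚ.∈? B)) τ _ ≤-refl x∉
  ...   | v , v∉ , least with start v
  ...     | inj₁ v∈ = contradiction v∈ v∉
  rank-forcing rank cover edges {B} zero n≤ start | yes _ | v , v∉ , least | inj₂ _ =
    contradiction (<-≤-trans (≤-<-trans n≤ (∣B∣<∣B∪v∣ v∉)) (∣p∣≤n (B ∪ ⁅ v ⁆))) (<-irrefl refl)
  rank-forcing {qs} {τ} rank cover edges {B} (suc k) n≤ start | yes _ | v , v∉ , least | inj₂ (u , s) =
    case rank-forcing rank cover edges k
           (≤-trans n≤ (≤-trans (≤-reflexive (≡-sym (+-suc k ∣ B ∣))) (+-monoʳ-≤ k (∣B∣<∣B∪v∣ v∉))))
           (λ x → Sum.map₁ (p⊆p∪q ⁅ v ⁆) (start x))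
    of λ (fs , (valid , full) , steps) →
      (u , v) ∷ fs , ((canForce , valid) , full) , λ { (here refl) → s ; (there h) → steps h }
    where
    black : ∀ {w} → τ w < τ v → w ∈ₛ B
    black {w} lt = decidable-stable (w Subsetₚ.∈? B) λ w∉ → <⇒≱ lt (least w w∉)
    canForce : CanForce G B u v
    canForce = black (proj₁ (rank s)) , v∉ , edges s , λ w a w≢v → black (proj₂ (rank s) w (cover w) a w≢v)

  step⇒chainLinks : ∀ {fs} c → (∀ {x y} → Step x y c → (x , y) ∈ fs) → ChainLinks G fs c
  step⇒chainLinks [] h = tt
  step⇒chainLinks (x ∷ []) h = tt
  step⇒chainLinks (x ∷ y ∷ c) h = h here , step⇒chainLinks (y ∷ c) (h ∘ there)

  chainLinks⇒step : ∀ {fs} c → ChainLinks G fs c → ∀ {x y} → Step x y c → (x , y) ∈ fs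
  chainLinks⇒step (x ∷ y ∷ c) (l , ls) here = l
  chainLinks⇒step (x ∷ y ∷ c) (l , ls) (there s) = chainLinks⇒step (y ∷ c) ls s

  -- Maximal forcing chains are the oriented paths

  module Chains {qs : List (List (Fin n))} (uniq : Unique (concat qs)) (nonempty : All (_≢ []) qs)
    (cover : ∀ x → x ∈ concat qs) {fs : List (Force G)}
    (forced : ∀ {u v} → (u , v) ∈ fs → Any (Step u v) qs)
    (complete : ∀ {u v} → Any (Step u v) qs → (u , v) ∈ fs) where

    step-fromˡ : ∀ {x y q} → q ∈ qs → x ∈ q → (x , y) ∈ fs → Step x y q
    step-fromˡ q∈ x∈ h with find (forced h)
    ... | q′ , q′∈ , s with unique-concat⇒≡ qs uniq (step-∈ˡ s) q′∈ x∈ q∈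
    ...   | refl = s

    step-fromʳ : ∀ {x y q} → q ∈ qs → y ∈ q → (x , y) ∈ fs → Step x y q
    step-fromʳ q∈ y∈ h with find (forced h)
    ... | q′ , q′∈ , s with unique-concat⇒≡ qs uniq (step-∈ʳ s) q′∈ y∈ q∈
    ...   | refl = s

    path-chain : ∀ {q} → q ∈ qs → IsForcingChain G fs q
    path-chain {q} q∈ = All.lookup nonempty q∈ , step⇒chainLinks q λ s → complete (lose q∈ s)

    -- An extension to the left would force the head of `q`, which has no predecessor; one to the
    -- right would give its last vertex a successor.
    path-maximal : ∀ {q} → q ∈ qs → IsMaximalForcingChain G fs q
    path-maximal {q} q∈ = path-chain q∈ , λ (as , bs , ne , _ , links) →
      no-extension as bs ne (chainLinks⇒step (as ++ q ++ bs) links)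
      where
      u : Unique q
      u = unique-member qs uniq q∈
      before : ∀ {q} → q ∈ qs → Unique q → ∀ a as bs →
        (∀ {x y} → Step x y ((a ∷ as) ++ q ++ bs) → (x , y) ∈ fs) → ⊥
      before {[]} q∈ _ a as bs h = All.lookup nonempty q∈ refl
      before {x ∷ q} q∈ u a as bs h with has-pred {z = a} (∈-++⁺ʳ as (here {xs = q ++ bs} refl))
      ... | z , s = head-no-pred u (step-fromʳ q∈ (here refl) (h s))
      after : ∀ {q} → q ∈ qs → Unique q → ∀ b bs →
        (∀ {x y} → Step x y (q ++ b ∷ bs) → (x , y) ∈ fs) → ⊥
      after {q} q∈ u b bs h with initLast q
      ... | [] = All.lookup nonempty q∈ refl
      ... | q′ ∷ʳ′ z with step-suffix q′ u (step-fromˡ q∈ (∈-++⁺ʳ q′ (here refl))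
                (h (subst (Step z b) (≡-sym (++-assoc q′ [ z ] (b ∷ bs))) (step-++ʳ q′ here))))
      ...   | _ , ()
      no-extension : ∀ as bs → as ++ bs ≢ [] →
        (∀ {x y} → Step x y (as ++ q ++ bs) → (x , y) ∈ fs) → ⊥
      no-extension [] [] ne h = ne refl
      no-extension [] (b ∷ bs) ne h = after q∈ u b bs h
      no-extension (a ∷ as) bs ne h = before q∈ u a as bs h

    chain-prefix : ∀ ys x zs c → ys ++ x ∷ zs ∈ qs → (∀ {u v} → Step u v (x ∷ c) → (u , v) ∈ fs) →
      ∃ λ bs → zs ≡ c ++ bs
    chain-prefix ys x zs [] q∈ h = zs , refl
    chain-prefix ys x zs (y ∷ c) q∈ h
      with step-suffix ys (unique-member qs uniq q∈) (step-fromˡ q∈ (∈-++⁺ʳ ys (here refl)) (h here))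
    ... | zs′ , refl with chain-prefix (ys ++ [ x ]) y zs′ c
            (subst (_∈ qs) (≡-sym (++-assoc ys [ x ] (y ∷ zs′))) q∈) (h ∘ there)
    ...   | bs , refl = bs , refl

    -- From its first vertex on, the chain follows the path through that vertex. Whatever the path
    -- has before or after the chain would extend it, so by maximality both remainders are empty.
    maximal-path : ∀ {c} → IsMaximalForcingChain G fs c → c ∈ qs
    maximal-path {[]} ((ne , _) , _) = contradiction refl ne
    maximal-path {x ∷ c} ((_ , links) , maximal) with ∈-concat⁻′ qs (cover x)
    ... | q , x∈q , q∈ with ∈-∃++ x∈q
    ...   | ys , zs , refl with chain-prefix ys x zs c q∈ (chainLinks⇒step (x ∷ c) links)
    maximal-path ((_ , links) , maximal) | q , x∈q , q∈ | [] , zs , refl | [] , refl =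
      subst (_∈ qs) (++-identityʳ _) q∈
    maximal-path ((_ , links) , maximal) | q , x∈q , q∈ | [] , zs , refl | b ∷ bs , refl =
      contradiction ([] , b ∷ bs , (λ ()) , path-chain q∈) maximal
    maximal-path ((_ , links) , maximal) | q , x∈q , q∈ | y ∷ ys , zs , refl | bs , refl =
      contradiction (y ∷ ys , bs , (λ ()) , path-chain q∈) maximal

  orientation-all : ∀ {P : List (Fin n) → Set} → (∀ {p q} → P p → Oriented G p q → P q) →
    ∀ {ps qs} → Orientation G ps qs → All P ps → All P qs
  orientation-all f [] [] = []
  orientation-all f (o ∷ os) (p ∷ ps) = f p o ∷ orientation-all f os ps

  oriented-forcing : ∀ {ps qs τ} → IsPathCover G ps → Orientation G ps qs → IsRank G qs τ →
    ∃ λ Z → StartSet G qs Z × ∣ Z ∣ ≡ length ps × ∃ λ fs → CompleteForcing G Z fs ×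
      (∀ c → IsMaximalForcingChain G fs c ⇔ c ∈ qs)
  oriented-forcing {ps} {qs} (induced , perm) os rank =
    Z , (λ x → mk⇔ (heads⁻ qs ∘ fromList⁻ (heads qs)) (fromList⁺ ∘ heads⁺)) , size ,
    fs , complete , λ c → mk⇔ C.maximal-path C.path-maximal
    where
    qs↭ : concat qs ↭ allFin n
    qs↭ = ↭-trans (orientation-concat G os) perm
    uniq : Unique (concat qs)
    uniq = unique-↭ (↭-sym qs↭) (Uniqueₚ.allFin⁺ n)
    cover : ∀ x → x ∈ concat qs
    cover x = ∈-resp-↭ (↭-sym qs↭) (∈-allFin x)
    nonempty : All (_≢ []) qs
    nonempty = orientation-all (λ { ne o refl → ne (↭-empty-inv (↭-sym (oriented-↭ G o))) })
      os (All.tabulate λ p∈ → proj₁ (induced _ p∈))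
    paths : All (InducedPath G) qs
    paths = orientation-all (oriented-inducedPath G) os
      (All.tabulate λ p∈ → isInducedPath⇒inducedPath G (induced _ p∈))
    edges : ∀ {x y} → Any (Step x y) qs → Adj G x y
    edges s with find s
    ... | q , q∈ , s′ = InducedPath.edge (All.lookup paths q∈) s′
    Z : Subset n
    Z = fromList (heads qs)
    size : ∣ Z ∣ ≡ length ps
    size = ≡-trans (∣∣-unique (heads-unique qs uniq) (fromList⁻ (heads qs)) fromList⁺)
      (≡-trans (length-heads nonempty) (≡-sym (Pointwise-length os)))
    start : ∀ x → x ∈ₛ Z ⊎ ∃ λ u → Any (Step u x) qs
    start x with find (∈-concat⁻ qs (cover x))
    ... | _ ∷ _ , q∈ , here refl = inj₁ (fromList⁺ (heads⁺ (lose q∈ refl)))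
    ... | _ ∷ _ , q∈ , there x∈ with has-pred x∈
    ...   | u , s = inj₂ (u , lose q∈ s)
    forcing = rank-forcing rank cover edges n (m≤m+n n ∣ Z ∣) start
    fs = proj₁ forcing
    complete = proj₁ (proj₂ forcing)
    forced : ∀ {u v} → (u , v) ∈ fs → Any (Step u v) qs
    forced = proj₂ (proj₂ forcing)
    -- In the end `v` is black. It is not an initial vertex, since heads have no predecessor, so
    -- some force reaches it; that force is a step too, and predecessors on a path are unique.
    steps-forced : ∀ {u v} → Any (Step u v) qs → (u , v) ∈ fs
    steps-forced {u} {v} s with find s
    ... | q , q∈ , s′ with afterForces⁻ fs (proj₂ complete v)
    ...   | inj₂ (u′ , h) with find (forced h)
    ...     | q′ , q′∈ , t with unique-concat⇒≡ qs uniq (step-∈ʳ t) q′∈ (step-∈ʳ s′) q∈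
    ...       | refl with step-injective (unique-member qs uniq q∈) s′ t
    ...         | refl = h
    steps-forced {u} {v} s | q , q∈ , s′ | inj₁ v∈Z with find (heads⁻ qs (fromList⁻ (heads qs) v∈Z))
    ... | _ ∷ _ , q′∈ , refl with unique-concat⇒≡ qs uniq (here refl) q′∈ (step-∈ʳ s′) q∈
    ...   | refl = contradiction s′ (head-no-pred (unique-member qs uniq q∈))
    module C = Chains uniq nonempty cover forced steps-forced

-- Path covers from zero forcing sets

module _ {n : ℕ} (G : Graph n) where

  inducedPath-∷ : ∀ {u v r} → IsInducedPath G (u ∷ r) → v ∉ u ∷ r → Adj G v u →
    (∀ {x} → x ∈ r → ¬ Adj G v x) → IsInducedPath G (v ∷ u ∷ r)
  inducedPath-∷ {u} {v} {r} (_ , uniq , adj⇔) v∉ vu v≁r = (λ ()) , unique-∷⁺ v∉ uniq , adj⇔′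
    where
    adj⇔′ : ∀ i j → Adj G (lookup (v ∷ u ∷ r) i) (lookup (v ∷ u ∷ r) j) ⇔
              (toℕ j ≡ suc (toℕ i) ⊎ toℕ i ≡ suc (toℕ j))
    adj⇔′ zero zero = mk⇔ (λ a → contradiction refl (adj-≢ G a)) λ { (inj₁ ()) ; (inj₂ ()) }
    adj⇔′ zero (suc zero) = mk⇔ (λ _ → inj₁ refl) (λ _ → vu)
    adj⇔′ (suc zero) zero = mk⇔ (λ _ → inj₂ refl) (λ _ → adj-sym G vu)
    adj⇔′ zero (suc (suc j)) =
      mk⇔ (λ a → contradiction a (v≁r (∈-lookup j))) λ { (inj₁ ()) ; (inj₂ ()) }
    adj⇔′ (suc (suc i)) zero =
      mk⇔ (λ a → contradiction (adj-sym G a) (v≁r (∈-lookup i))) λ { (inj₁ ()) ; (inj₂ ()) }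
    adj⇔′ (suc i) (suc j) = mk⇔
      (λ a → Sum.map (cong suc) (cong suc) (to (adj⇔ i j) a))
      (λ e → from (adj⇔ i j) (Sum.map suc-injective suc-injective e))

  -- The forcing chains built so far, each written backwards, so that its head is its last vertex.
  record ChainCover (B : Subset n) (ps : List (List (Fin n))) : Set where
    field
      induced  : All (IsInducedPath G) ps
      distinct : Unique (concat ps)
      sound    : ∀ {x} → x ∈ concat ps → x ∈ₛ B
      complete : ∀ {x} → x ∈ₛ B → x ∈ concat ps
      used     : ∀ {a r} → (a ∷ r) ∈ ps → ∀ {x w} → x ∈ r → Adj G x w → w ∈ₛ B

  open ChainCover

  chainCover-↭ : ∀ {B ps qs} → ps ↭ qs → ChainCover B ps → ChainCover B qs
  chainCover-↭ perm cc = record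
    { induced = All-resp-↭ perm (induced cc)
    ; distinct = unique-↭ (concat-↭ perm) (distinct cc)
    ; sound = sound cc ∘ ∈-resp-↭ (concat-↭ (↭-sym perm))
    ; complete = ∈-resp-↭ (concat-↭ perm) ∘ complete cc
    ; used = used cc ∘ ∈-resp-↭ (↭-sym perm)
    }

  singletons-cover : ∀ B → ChainCover B (map [_] (elements B))
  singletons-cover B = record
    { induced = Allₚ.map⁺ (All.tabulate λ {x} _ → singleton x)
    ; distinct = subst Unique (≡-sym flat) (elements-unique B)
    ; sound = λ {x} x∈ → elements⁻ B (subst (x ∈_) flat x∈)
    ; complete = λ {x} x∈ → subst (x ∈_) (≡-sym flat) (elements⁺ x∈)
    ; used = λ p∈ x∈ → case ∈-map⁻ [_] p∈ of λ { (_ , _ , refl) → case x∈ of λ () }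
    }
    where
    flat : concat (map [_] (elements B)) ≡ elements B
    flat = concat-map-[ elements B ]
    singleton : ∀ x → IsInducedPath G [ x ]
    singleton x = (λ ()) , [] ∷ [] , λ where
      zero zero → mk⇔ (λ a → contradiction refl (adj-≢ G a)) λ { (inj₁ ()) ; (inj₂ ()) }

  -- By `used`, vertices behind the head have only black neighbours, so none is adjacent to the
  -- white `v` and the longer chain stays induced. After the force all neighbours of `u` are black
  -- too, which restores `used`.
  chainCover-∷ : ∀ {B u v r rest} → ChainCover B ((u ∷ r) ∷ rest) → CanForce G B u v →
    ChainCover (B ∪ ⁅ v ⁆) ((v ∷ u ∷ r) ∷ rest)
  chainCover-∷ {B} {u} {v} {r} {rest} cc (u∈ , v∉ , uv , others) = record
    { induced = inducedPath-∷ (All.head (induced cc)) (v∉ ∘ sound cc ∘ ∈-++⁺ˡ) (adj-sym G uv)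
        (λ x∈ a → v∉ (used cc (here refl) x∈ (adj-sym G a))) ∷ All.tail (induced cc)
    ; distinct = unique-∷⁺ (v∉ ∘ sound cc) (distinct cc)
    ; sound = λ { (here refl) → q⊆p∪q B ⁅ v ⁆ (x∈⁅x⁆ v) ; (there x∈) → p⊆p∪q ⁅ v ⁆ (sound cc x∈) }
    ; complete = λ x∈ → [ there ∘ complete cc , here ]′ (∈-∪⁅⁆⁻ x∈)
    ; used = used′
    }
    where
    used′ : ∀ {a s} → (a ∷ s) ∈ ((v ∷ u ∷ r) ∷ rest) → ∀ {x w} → x ∈ s → Adj G x w → w ∈ₛ B ∪ ⁅ v ⁆
    used′ (there p∈) x∈ a = p⊆p∪q ⁅ v ⁆ (used cc (there p∈) x∈ a)
    used′ (here refl) (there x∈) a = p⊆p∪q ⁅ v ⁆ (used cc (here refl) x∈ a)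
    used′ (here refl) {w = w} (here refl) a with w Finₚ.≟ v
    ... | yes refl = q⊆p∪q B ⁅ v ⁆ (x∈⁅x⁆ v)
    ... | no w≢v = p⊆p∪q ⁅ v ⁆ (others w a w≢v)

  chainCover-force : ∀ {B u v ps} → ChainCover B ps → CanForce G B u v →
    ∃ λ qs → ChainCover (B ∪ ⁅ v ⁆) qs × length qs ≡ length ps
  chainCover-force {ps = ps} cc cf@(u∈ , v∉ , uv , _) with ∈-concat⁻′ ps (complete cc u∈)
  -- A forcing vertex is the head of its chain: behind the head every neighbour is black already,
  -- but `v` is white.
  ... | a ∷ r , there u∈r , p∈ = contradiction (used cc p∈ u∈r uv) v∉
  ... | u ∷ r , here refl , p∈ with ∈⇒↭∷ p∈
  ...   | rest , perm = _ , chainCover-∷ (chainCover-↭ perm cc) cf , ≡-sym (↭-length perm)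

  chainCover-forces : ∀ {B ps} fs → ChainCover B ps → ValidForces G B fs →
    ∃ λ qs → ChainCover (afterForces G B fs) qs × length qs ≡ length ps
  chainCover-forces [] cc _ = _ , cc , refl
  chainCover-forces (f ∷ fs) cc (cf , valid) with chainCover-force cc cf
  ... | qs , cc′ , len with chainCover-forces fs cc′ valid
  ...   | qs′ , cc″ , len′ = qs′ , cc″ , ≡-trans len′ len

  forcing-pathCover : ∀ {Z} → IsZeroForcingSet G Z → ∃ λ ps → IsPathCover G ps × length ps ≡ ∣ Z ∣
  forcing-pathCover {Z} (fs , valid , full) with chainCover-forces fs (singletons-cover Z) valid
  ... | ps , cc , len = ps ,
    ((λ p p∈ → All.lookup (induced cc) p∈) ,
     unique-set⇒↭ (distinct cc) (Uniqueₚ.allFin⁺ n) (λ {x} _ → ∈-allFin x) (λ {x} _ → complete cc (full x))) ,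
    ≡-trans len (≡-trans (length-map [_] (elements Z)) (length-elements Z))

  -- Deciding zero forcing and finding a minimum set

  canForce? : ∀ B u v → Dec (CanForce G B u v)
  canForce? B u v = (u Subsetₚ.∈? B) ×-dec ¬? (v Subsetₚ.∈? B) ×-dec (adj G u v Boolₚ.≟ true) ×-dec
    Finₚ.all? λ w → (adj G u w Boolₚ.≟ true) →-dec ¬? (w Finₚ.≟ v) →-dec (w Subsetₚ.∈? B)

  -- Every possible first force is tried. Each one blackens a new vertex, so the recursion is
  -- bounded by `k`, an upper bound for the number of white vertices.
  zeroForcing? : ∀ k B → n ≤ k + ∣ B ∣ → Dec (IsZeroForcingSet G B)
  zeroForcing? k B n≤ with Finₚ.all? (Subsetₚ._∈? B)
  ... | yes full = yes ([] , tt , full)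
  zeroForcing? zero B n≤ | no ¬full = no λ where
    ([] , _ , full) → ¬full full
    ((u , v) ∷ _ , ((_ , v∉ , _) , _) , _) →
      <-irrefl refl (<-≤-trans (≤-<-trans n≤ (∣B∣<∣B∪v∣ v∉)) (∣p∣≤n (B ∪ ⁅ v ⁆)))
  zeroForcing? (suc k) B n≤ | no ¬full with Finₚ.any? (λ u → Finₚ.any? (λ v → first u v))
    where
    first : ∀ u v → Dec (CanForce G B u v × IsZeroForcingSet G (B ∪ ⁅ v ⁆))
    first u v with canForce? B u v
    ... | no ¬cf = no (¬cf ∘ proj₁)
    ... | yes cf@(_ , v∉ , _) with zeroForcing? k (B ∪ ⁅ v ⁆)
            (≤-trans n≤ (≤-trans (≤-reflexive (≡-sym (+-suc k ∣ B ∣))) (+-monoʳ-≤ k (∣B∣<∣B∪v∣ v∉))))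
    ...   | yes z = yes (cf , z)
    ...   | no ¬z = no (¬z ∘ proj₂)
  ... | yes (u , v , cf , fs , valid , full) = yes ((u , v) ∷ fs , (cf , valid) , full)
  ... | no none = no λ where
    ([] , _ , full) → ¬full full
    ((u , v) ∷ fs , (cf , valid) , full) → none (u , v , cf , fs , valid , full)

  minimum-forcing : ∀ k Z → ∣ Z ∣ ≤ k → IsZeroForcingSet G Z → ∃ (IsMinZeroForcingSet G)
  minimum-forcing k Z Z≤k zf
    with anySubset? (λ Y → zeroForcing? n Y (m≤m+n n ∣ Y ∣) ×-dec (∣ Y ∣ <? ∣ Z ∣))
  ... | no none = Z , zf , λ Y zfY → ≮⇒≥ λ lt → none (Y , zfY , lt)
  minimum-forcing zero Z Z≤k zf | yes (Y , zfY , lt) = contradiction (<-≤-trans lt Z≤k) λ ()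
  minimum-forcing (suc k) Z Z≤k zf | yes (Y , zfY , lt) =
    minimum-forcing k Y (≤-pred (<-≤-trans lt Z≤k)) zfY

theorem4p17 : ∀ {n : ℕ} (G : Graph n) → BlockCycle G →
    Σ ℕ λ k → IsZeroForcingNumber G k × IsPathCoverNumber G k ×
    (∀ (ps : List (List (Fin n))) → IsPathCover G ps → length ps ≡ k →
    Σ (List (List (Fin n))) λ qs → Orientation G ps qs ×
    Σ (Subset n) λ Z → StartSet G qs Z × IsMinZeroForcingSet G Z ×
    ∃[ fs ] (CompleteForcing G Z fs ×
    (∀ c → IsMaximalForcingChain G fs c ⇔ c ∈ qs)))
theorem4p17 {n} G bc with minimum-forcing G n ⊤ (∣p∣≤n ⊤) ([] , tt , λ _ → ∈⊤)
... | Z₀ , zf₀ , minimal = ∣ Z₀ ∣ ,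
  ((Z₀ , zf₀ , refl) , minimal) ,
  (forcing-pathCover G zf₀ , λ ps cover → bound ps cover) ,
  λ ps cover len → case oriented-rank G bc cover of λ (qs , os , _ , rank) →
    case oriented-forcing G cover os rank of λ (Z , starts , size , fs , complete , chains) →
      qs , os , Z , starts ,
      ((fs , complete) , λ Z′ zf → ≤-trans (≤-reflexive (≡-trans size len)) (minimal Z′ zf)) ,
      fs , complete , chains
  where
  -- Every path cover, minimum or not, orients to a zero forcing set with one vertex per path.
  bound : ∀ ps → IsPathCover G ps → ∣ Z₀ ∣ ≤ length ps
  bound ps cover with oriented-rank G bc cover
  ... | qs , os , _ , rank with oriented-forcing G cover os rank
  ...   | Z , _ , size , fs , complete , _ = ≤-trans (minimal Z (fs , complete)) (≤-reflexive size)
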